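{- Let $i\ge 3$ and $k\ge 3$ be integers. Then: (a) $g_2(F_i,F_{i+2},F_{i+k})=(3F_i-1)F_{i+2}-F_i$ whenever $k\ge i+3$; (b) $g_2(F_i,F_{i+2},F_{2i+2})=(F_{i-2}-1)F_{i+2}+F_{2i+2}-F_i$ if $i$ is odd, and $g_2(F_i,F_{i+2},F_{2i+2})=(F_{i+2}-1)F_{i+2}-F_i$ if $i$ is even; (c) $g_2(F_i,F_{i+2},F_{2i+1})=(F_i-1)F_{i+2}+F_{2i+1}-F_i$; (d) $g_2(F_i,F_{i+2},F_{2i})=(2F_i-1)F_{i+2}-F_i$; (e) $g_2(F_i,F_{i+2},F_{2i-1})=(F_{i-4}-1)F_{i+2}+3F_{2i-1}-F_i$ for $i\ge 5$, and $g_2(F_4,F_6,F_7)=F_6+2F_7-F_4=31$; (f) if $r=\lfloor (F_i-1)/F_k\rfloor\ge 2$ (equivalently $k\le i-2$), then $$g_2(F_i,F_{i+2},F_{i+k})=\begin{cases}(F_i-rF_k-1)F_{i+2}+(r+2)F_{i+k}-F_i & \text{if } (F_i-rF_k)F_{i+2}\ge F_{k-2}F_i,\\ (F_k-1)F_{i+2}+(r+1)F_{i+k}-F_i & \text{if } (F_i-rF_k)F_{i+2}< F_{k-2}F_i.\end{cases}$$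
   Context: Fibonacci numbers: $F_0=0$, $F_1=1$, $F_n=F_{n-1}+F_{n-2}$. For positive integers $a_1,\dots,a_l$ with $\gcd(a_1,\dots,a_l)=1$ and an integer $n$, let $d(n;a_1,\dots,a_l)$ be the number of tuples $(x_1,\dots,x_l)$ of nonnegative integers with $a_1x_1+\dots+a_lx_l=n$. For a nonnegative integer $p$, the $p$-Frobenius number $g_p(a_1,\dots,a_l)$ is the largest integer $n$ with $d(n;a_1,\dots,a_l)\le p$. -}

module Defs where

open import Data.Nat.Base as ℕ using (ℕ; zero; suc; NonZero; z≤n; s≤s)
import Data.Nat.Properties as ℕ
open import Data.Nat.GCD using (gcd)
open import Data.Integer.Base using (ℤ; +_; ∣_∣; _≤_)
open import Data.Integer.Properties using (_≟_)
open import Data.List.Base as List using (List; []; _∷_)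
open import Data.List.Membership.Propositional using (_∈_)
open import Data.List.Membership.Propositional.Properties
  using (∈-cartesianProductWith⁺; ∈-filter⁺; ∈-filter⁻; ∈-upTo⁺)
open import Data.List.Relation.Unary.Any using (here)
open import Data.List.Relation.Unary.Unique.Propositional using (Unique)
open import Data.List.Relation.Unary.Unique.Propositional.Properties as Unique
  using (upTo⁺)
import Data.List.Relation.Unary.All as ListAll
import Data.List.Relation.Unary.AllPairs as AllPairs
open import Data.Product.Base using (_×_; _,_; proj₂)
open import Data.Vec.Base as Vec using (Vec; []; _∷_)
open import Data.Vec.Properties using (∷-injective)
open import Data.Vec.Relation.Unary.All as All using (All; []; _∷_)
open import Function.Bundles using (_⇔_; mk⇔)
open import Relation.Binary.PropositionalEquality using (_≡_; refl; sym; cong; subst)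

F : ℕ → ℕ
F zero          = 0
F (suc zero)    = 1
F (suc (suc n)) = F (suc n) ℕ.+ F n

F-positive : ∀ n → 0 ℕ.< F (suc n)
F-positive zero    = s≤s z≤n
F-positive (suc n) = ℕ.≤-trans (F-positive n) (ℕ.m≤m+n _ _)

F-nonZero : ∀ {m k} → suc m ℕ.≤ k → NonZero (F k)
F-nonZero {k = suc k} _ = ℕ.>-nonZero (F-positive k)

_·_ : ∀ {l} → Vec ℕ l → Vec ℕ l → ℕ
a · x = Vec.sum (Vec.zipWith ℕ._*_ a x)

tuples : ∀ l → ℕ → List (Vec ℕ l)
tuples zero    b = [] ∷ []
tuples (suc l) b =
  List.cartesianProductWith _∷_ (List.upTo (suc b)) (tuples l b)

-- Positivity of the aⱼ forces every solution of a · x ≡ n to have all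
-- entries at most n, so the bounded search is exhaustive; see ∈-solutions.
solutions : ∀ {l} → ℤ → Vec ℕ l → List (Vec ℕ l)
solutions {l} n a = List.filter (λ x → + (a · x) ≟ n) (tuples l ∣ n ∣)

d : ∀ {l} → ℤ → Vec ℕ l → ℕ
d n a = List.length (solutions n a)

record IsFrobeniusNumber {l} (p : ℕ) (a : Vec ℕ l) (g : ℤ) : Set where
  field
    positive : All NonZero a
    coprime  : Vec.foldr′ gcd 0 a ≡ 1
    few      : d g a ℕ.≤ p
    largest  : ∀ n → d n a ℕ.≤ p → n ≤ g

tuples-unique : ∀ l b → Unique (tuples l b)
tuples-unique zero    b = ListAll.[] AllPairs.∷ AllPairs.[]
tuples-unique (suc l) b =
  Unique.cartesianProductWith⁺ _∷_ ∷-injective (upTo⁺ (suc b)) (tuples-unique l b)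

solutions-unique : ∀ {l} n (a : Vec ℕ l) → Unique (solutions n a)
solutions-unique {l} n a =
  Unique.filter⁺ (λ x → + (a · x) ≟ n) (tuples-unique l ∣ n ∣)

∈-tuples : ∀ {l b} (a x : Vec ℕ l) → All NonZero a → a · x ℕ.≤ b → x ∈ tuples l b
∈-tuples []      []      []           _ = here refl
∈-tuples (c ∷ a) (y ∷ x) (c≢0 ∷ a≢0) h =
  ∈-cartesianProductWith⁺ _∷_
    (∈-upTo⁺ (s≤s (ℕ.≤-trans (ℕ.m≤n*m y c {{c≢0}}) (ℕ.m+n≤o⇒m≤o (c ℕ.* y) h))))
    (∈-tuples a x a≢0 (ℕ.m+n≤o⇒n≤o (c ℕ.* y) h))

∈-solutions : ∀ {l} n (a x : Vec ℕ l) → All NonZero a →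
              x ∈ solutions n a ⇔ + (a · x) ≡ n
∈-solutions {l} n a x a≢0 = mk⇔
  (λ x∈ → proj₂ (∈-filter⁻ P? {xs = tuples l ∣ n ∣} x∈))
  (λ eq → ∈-filter⁺ P? (∈-tuples a x a≢0 (ℕ.≤-reflexive (cong ∣_∣ eq))) eq)
  where
  P? = λ (x : Vec ℕ l) → + (a · x) ≟ n

{-# OPTIONS --safe #-}

-- Write a = F i, b = F (i + 2), c = F (i + k), q = F k and e = F (k - 2), so that
-- c + e a = q b.  Modulo a this makes b y + c z congruent to b (y + q z), where b is
-- a unit, so up to x a representation a x + b y + c z is governed by t = y + q z, and
-- b y + c z = b t - e a z.
--
-- Put the claimed value in the form g = b Y + c Z - a and let T = Y + q Z.
-- Every number above g has three representations as soon as each residue s mod a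
-- has three pairs (y, z) with t = s mod a and b y + c z ≤ b Y + c Z: in all cases
-- they can be found among t = s, s + a, s + 2 a.  Conversely a representation of g
-- satisfies t + w a = T and x + 1 + e Z = w b + e z for some w ≥ 0; the pair (w, z)
-- determines it, and only two pairs leave x, y ≥ 0.
module Submission where

open import Defs

-- For a fixed t the weight b t - e a z falls as z grows, so the lightest pair is the greedy one,
-- with y < q. The value g + a is the largest weight that any residue is made to accept for its
-- third pair. This is where Y and Z come from. The residues are cut into ranges according to how
-- many multiples of q fit into the t in use. Each range ends in one heaviest pair, and (Y, Z) is
-- the heaviest of these few candidates. The case distinctions of the statement only tell which one
-- wins: in (b) the sign in Cassini's identity, in (f) the comparison of (F_i - r F_k) b with e a.
-- Such comparisons are made after adding b to both weights, because q b can then be traded for c +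
-- e a. Which two pairs (w, z) survive for g depends on the size of q: (1, 0) and (2, 0) in (a) to
-- (c), (1, 0) and (0, 1) in (d), (1, 0) and (1, 1) in (e) and (f).

-- Here the unqualified operators are those of ℕ; below they are those of ℤ.
module OverNaturals where

  open import Data.Empty using (⊥; ⊥-elim)
  open import Data.Fin.Base using (zero; suc)
  open import Data.Fin.Properties using (injective⇒≤)
  open import Data.Integer.Base as ℤ using (+_)
  import Data.Integer.Properties as ℤ
  open import Data.List.Base using (List; []; _∷_; length; lookup)
  open import Data.List.Membership.Propositional using (_∈_)
  open import Data.List.Membership.Propositional.Properties using (∈-lookup)
  open import Data.List.Relation.Unary.All as ListAll using ([]; _∷_)
  open import Data.List.Relation.Unary.AllPairs using ([]; _∷_)
  open import Data.List.Relation.Unary.Any using (here; there; index)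
  open import Data.List.Relation.Unary.Any.Properties using (lookup-index)
  open import Data.List.Relation.Unary.Unique.Propositional using (Unique)
  open import Data.Nat.Base hiding (_/_; _%_)
  open import Data.Nat.Coprimality as Coprimality
    using (Coprime; coprime-+; coprime-Bézout; coprime-divisor)
  open import Data.Nat.Divisibility
  open import Data.Nat.DivMod using (_/_; _%_; m≡m%n+[m/n]*n; m%n<n)
  open import Data.Nat.GCD using (gcd; gcd[m,n]∣m; gcd[m,n]∣n; module Bézout)
  open import Data.Nat.Properties
  open import Data.Nat.Tactic.RingSolver using (solve-∀)
  open import Data.Product.Base using (_×_; _,_; proj₁; proj₂; ∃; ∃₂)
  open import Data.Sum.Base using (_⊎_; inj₁; inj₂)
  open import Data.Unit.Base using (tt)
  open import Data.Vec.Base using (Vec; []; _∷_; foldr′)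
  open import Data.Vec.Relation.Unary.All as VecAll using ([]; _∷_)
  open import Function.Bundles using (Equivalence)
  open import Relation.Binary.PropositionalEquality

  -- Comparing the lengths of lists by injections

  lookup-injective : ∀ {A : Set} {xs : List A} → Unique xs →
                     ∀ {i j} → lookup xs i ≡ lookup xs j → i ≡ j
  lookup-injective (_  ∷ _) {zero}  {zero}  _  = refl
  lookup-injective (x∉ ∷ _) {zero}  {suc j} eq = ⊥-elim (ListAll.lookup x∉ (∈-lookup j) eq)
  lookup-injective (x∉ ∷ _) {suc i} {zero}  eq = ⊥-elim (ListAll.lookup x∉ (∈-lookup i) (sym eq))
  lookup-injective (_  ∷ u) {suc i} {suc j} eq = cong suc (lookup-injective u eq)

  -- Each position of `xs` goes to the position of a partner in `ys`, and an injection of finite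
  -- sets bounds the cardinality. A relation instead of a function leaves room for data known only
  -- to exist, such as the coefficient `x` that completes a light pair.
  length-≤-by-injection : ∀ {A B : Set} {xs : List A} {ys : List B} (R : A → B → Set) →
    Unique xs →
    (∀ {x} → x ∈ xs → ∃ λ y → y ∈ ys × R x y) →
    (∀ {x x′ y} → R x y → R x′ y → x ≡ x′) →
    length xs ≤ length ys
  length-≤-by-injection {xs = xs} {ys} R u total inj =
    injective⇒≤ {f = λ i → index (y∈ i)} λ {i} {j} eq → lookup-injective u (inj (related i)
      (subst (R (lookup xs j)) (trans (lookup-index (y∈ j))
        (trans (cong (lookup ys) (sym eq)) (sym (lookup-index (y∈ i))))) (related j)))
    where
    y∈ = λ i → proj₁ (proj₂ (total (∈-lookup {xs = xs} i)))
    related = λ i → proj₂ (proj₂ (total (∈-lookup {xs = xs} i)))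

  -- Congruences modulo a, written without subtraction

  inverse-mod : ∀ {a b} → Coprime a b → ∃ λ u → ∃₂ λ k l → 1 + k * a ≡ u * b + l * a
  inverse-mod {a} {b} cop with coprime-Bézout cop
  ... | Bézout.-+ x y eq = y , x , 0 , trans eq (sym (+-identityʳ (y * b)))
  -- Here `y * b` is -1 modulo `a`; its square is 1, so `y * b * y` inverts `b`.
  ... | Bézout.+- x y eq = y * b * y , x * a * x , 2 * x , (begin
    1 + x * a * x * a                        ≡⟨ cong suc (*-assoc (x * a) x a) ⟩
    1 + x * a * (x * a)                      ≡⟨ cong (λ t → 1 + t * t) (sym eq) ⟩
    1 + (1 + y * b) * (1 + y * b)            ≡⟨ square (y * b) ⟩
    y * b * (y * b) + 2 * (1 + y * b)        ≡⟨ cong₂ (λ s t → s + 2 * t) (sym (*-assoc (y * b) y b)) eq ⟩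
    y * b * y * b + 2 * (x * a)              ≡⟨ cong (λ t → y * b * y * b + t) (sym (*-assoc 2 x a)) ⟩
    y * b * y * b + 2 * x * a                ∎)
    where
    open ≡-Reasoning
    square : ∀ t → 1 + (1 + t) * (1 + t) ≡ t * t + 2 * (1 + t)
    square = solve-∀

  residue : ∀ {a b} .{{_ : NonZero a}} → Coprime a b →
            ∀ n → ∃ λ s → s < a × ∃₂ λ k l → n + k * a ≡ s * b + l * a
  residue {a} {b} cop n with u , k , l , eq ← inverse-mod cop =
    s , m%n<n (n * u) a , n * k , t * b + n * l , (begin
    n + n * k * a                  ≡⟨ e₁ n k a ⟩
    n * (1 + k * a)                ≡⟨ cong (n *_) eq ⟩
    n * (u * b + l * a)            ≡⟨ e₂ n u b l a ⟩
    n * u * b + n * l * a          ≡⟨ cong (λ m → m * b + n * l * a) (m≡m%n+[m/n]*n (n * u) a) ⟩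
    (s + t * a) * b + n * l * a    ≡⟨ e₃ s t a b (n * l) ⟩
    s * b + (t * b + n * l) * a    ∎)
    where
    open ≡-Reasoning
    s = n * u % a
    t = n * u / a
    e₁ : ∀ n k a → n + n * k * a ≡ n * (1 + k * a)
    e₁ = solve-∀
    e₂ : ∀ n u b l a → n * (u * b + l * a) ≡ n * u * b + n * l * a
    e₂ = solve-∀
    e₃ : ∀ s t a b m → (s + t * a) * b + m * a ≡ s * b + (t * b + m) * a
    e₃ = solve-∀

  -- A number congruent to `n` and below `n + a` cannot exceed `n`. This gain of one `a` is the
  -- reason why weights are compared with g + a and not with g.
  congruent-below : ∀ {a w n} A B → w + A * a ≡ n + B * a → w < n + a → ∃ λ x → x * a + w ≡ n
  congruent-below {a} {w} {n} A B eq w<n+a with ≤-<-connex B A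
  ... | inj₁ B≤A with D , refl ← m≤n⇒∃[o]m+o≡n B≤A =
    D , +-cancelʳ-≡ (B * a) _ _ (trans (shuffle D a w B) eq)
    where
    shuffle : ∀ D a w B → D * a + w + B * a ≡ w + (B + D) * a
    shuffle = solve-∀
  ... | inj₂ A<B with D , refl ← m≤n⇒∃[o]m+o≡n A<B =
    ⊥-elim (<⇒≱ w<n+a (≤-trans (m≤m+n (n + a) (D * a)) (≤-reflexive (sym
      (+-cancelʳ-≡ (A * a) _ _ (trans eq (shuffle n A D a)))))))
    where
    shuffle : ∀ n A D a → n + suc (A + D) * a ≡ n + a + D * a + A * a
    shuffle = solve-∀

  -- The criterion for a Frobenius number

  module Criterion
    (a b c q e : ℕ) (c+ea≡qb : c + e * a ≡ q * b) (coprime-ab : Coprime a b)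
    (0<a : 0 < a) (0<q : 0 < q) (a≤b : a ≤ b) (a≤c : a ≤ c)
    where

    instance
      a-nonZero : NonZero a
      a-nonZero = >-nonZero 0<a

    generators : Vec ℕ 3
    generators = a ∷ b ∷ c ∷ []

    generators-nonZero : VecAll.All NonZero generators
    generators-nonZero =
      a-nonZero ∷ >-nonZero (<-≤-trans 0<a a≤b) ∷ >-nonZero (<-≤-trans 0<a a≤c) ∷ []

    generators-coprime : foldr′ gcd 0 generators ≡ 1
    generators-coprime = coprime-ab
      (gcd[m,n]∣m a _ , ∣-trans (gcd[m,n]∣n a _) (gcd[m,n]∣m b _))

    reweigh : ∀ y z → y * b + z * c + z * e * a ≡ (y + q * z) * b
    reweigh y z = begin
      y * b + z * c + z * e * a   ≡⟨ e₁ y b z c e a ⟩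
      y * b + z * (c + e * a)     ≡⟨ cong (λ t → y * b + z * t) c+ea≡qb ⟩
      y * b + z * (q * b)         ≡⟨ e₂ y b z q ⟩
      (y + q * z) * b             ∎
      where
      open ≡-Reasoning
      e₁ : ∀ y b z c e a → y * b + z * c + z * e * a ≡ y * b + z * (c + e * a)
      e₁ = solve-∀
      e₂ : ∀ y b z q → y * b + z * (q * b) ≡ (y + q * z) * b
      e₂ = solve-∀

    -- A pair that serves every n > g in the class of `s * b`: its weight is at most g + a, hence
    -- below n + a, and `congruent-below` supplies the coefficient of `a`.
    record Light (Y Z s : ℕ) (p : ℕ × ℕ) : Set where
      constructor light
      y = proj₁ p
      z = proj₂ p
      field
        j      : ℕ
        y-eq   : y + q * z ≡ s + j * a
        weight : y * b + z * c ≤ Y * b + Z * c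

    Lights : ℕ → ℕ → ℕ → ℕ → Set
    Lights p Y Z s = ∃ λ ps → length ps ≡ p × Unique ps × ListAll.All (Light Y Z s) ps

    length-light≤d : ∀ {Y Z g n s k l ps} → Y * b + Z * c ≡ g + a → g < n → n + k * a ≡ s * b + l * a →
                Unique ps → ListAll.All (Light Y Z s) ps → length ps ≤ d (+ n) generators
    length-light≤d {g = g} {n} {s} {k} {l} {ps} G≡ g<n n≡sb unique all-light =
      length-≤-by-injection R unique total inj
      where
      R : ℕ × ℕ → Vec ℕ 3 → Set
      R (y , z) v = ∃ λ x → v ≡ x ∷ y ∷ z ∷ []

      inj : ∀ {p p′ v} → R p v → R p′ v → p ≡ p′
      inj (_ , refl) (_ , refl) = refl

      congruence : ∀ y z j → y + q * z ≡ s + j * a →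
                   y * b + z * c + (z * e + l) * a ≡ n + (k + j * b) * a
      congruence y z j t≡ = begin
        y * b + z * c + (z * e + l) * a         ≡⟨ e₁ (y * b + z * c) (z * e) l a ⟩
        y * b + z * c + z * e * a + l * a       ≡⟨ cong (_+ l * a) (reweigh y z) ⟩
        (y + q * z) * b + l * a                 ≡⟨ cong (λ t → t * b + l * a) t≡ ⟩
        (s + j * a) * b + l * a                 ≡⟨ e₂ s j a b l ⟩
        s * b + l * a + j * b * a               ≡⟨ cong (_+ j * b * a) (sym n≡sb) ⟩
        n + k * a + j * b * a                   ≡⟨ e₃ n k a (j * b) ⟩
        n + (k + j * b) * a                     ∎
        where
        open ≡-Reasoning
        e₁ : ∀ w u l a → w + (u + l) * a ≡ w + u * a + l * a
        e₁ = solve-∀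
        e₂ : ∀ s j a b l → (s + j * a) * b + l * a ≡ s * b + l * a + j * b * a
        e₂ = solve-∀
        e₃ : ∀ n k a m → n + k * a + m * a ≡ n + (k + m) * a
        e₃ = solve-∀

      total : ∀ {p} → p ∈ ps → ∃ λ v → v ∈ solutions (+ n) generators × R p v
      total {y , z} p∈ps with light j t≡ w≤G ← ListAll.lookup all-light p∈ps
        with x , eq ← congruent-below {a} {y * b + z * c} {n} (z * e + l) (k + j * b)
               (congruence y z j t≡) (≤-<-trans (≤-trans w≤G (≤-reflexive G≡)) (+-monoˡ-< a g<n))
        = x ∷ y ∷ z ∷ [] ,
          Equivalence.from (∈-solutions (+ n) generators _ generators-nonZero)
            (cong +_ (trans (dot a x b y c z) eq)) ,
          x , refl
        where
        dot : ∀ a x b y c z → a * x + (b * y + (c * z + 0)) ≡ x * a + (y * b + z * c)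
        dot = solve-∀

    -- `x-eq` is the equation of weights divided by `a`; the successor on `x` appears because g lies
    -- one `a` below the weight of (Y, Z). The difference e (z - Z) is split over both sides, as
    -- either sign occurs.
    record Class (Y Z : ℕ) (v : Vec ℕ 3) (w z : ℕ) : Set where
      constructor class
      field
        {x y} : ℕ
        v≡    : v ≡ x ∷ y ∷ z ∷ []
        y-eq  : y + q * z + w * a ≡ Y + q * Z
        x-eq  : suc x + e * Z ≡ w * b + e * z

    class-injective : ∀ {Y Z v v′ w z} → Class Y Z v w z → Class Y Z v′ w z → v ≡ v′
    class-injective {Y} {Z} {w = w} {z} (class {x} {y} refl y-eq x-eq) (class {x′} {y′} refl y-eq′ x-eq′) =
      cong₂ (λ x y → x ∷ y ∷ z ∷ [])
        (suc-injective (+-cancelʳ-≡ (e * Z) _ _ (trans x-eq (sym x-eq′))))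
        (+-cancelʳ-≡ (q * z) _ _ (+-cancelʳ-≡ (w * a) _ _ (trans y-eq (sym y-eq′))))

    -- No solution has t = y + q z above T = Y + q Z: then e z would have to exceed e Z
    -- by more than b per a units of t, which is faster than e t / q grows.
    classify : ∀ Y Z → e * Y < c + q → ∀ x y z →
               suc x * a + (y * b + z * c) ≡ Y * b + Z * c →
               ∃ λ w → Class Y Z (x ∷ y ∷ z ∷ []) w z
    classify Y Z eY<c+q x y z eq = by-sign (≤-<-connex (y + q * z) (Y + q * Z))
      where
      open ≡-Reasoning

      balance : (suc x + e * Z) * a + (y + q * z) * b ≡ (Y + q * Z) * b + e * z * a
      balance = begin
        (suc x + e * Z) * a + (y + q * z) * b
          ≡⟨ cong (λ t → (suc x + e * Z) * a + t) (sym (reweigh y z)) ⟩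
        (suc x + e * Z) * a + (y * b + z * c + z * e * a)
          ≡⟨ arrange (suc x) Z e a (y * b + z * c) z ⟩
        suc x * a + (y * b + z * c) + Z * e * a + e * z * a
          ≡⟨ cong (λ t → t + Z * e * a + e * z * a) eq ⟩
        Y * b + Z * c + Z * e * a + e * z * a
          ≡⟨ cong (_+ e * z * a) (reweigh Y Z) ⟩
        (Y + q * Z) * b + e * z * a ∎
        where
        arrange : ∀ x Z e a v z → (x + e * Z) * a + (v + z * e * a) ≡ x * a + v + Z * e * a + e * z * a
        arrange = solve-∀

      below : ∀ δ → y + q * z + δ ≡ Y + q * Z → (suc x + e * Z) * a ≡ b * δ + e * z * a
      below δ T≡ = +-cancelʳ-≡ ((y + q * z) * b) _ _ (begin
        (suc x + e * Z) * a + (y + q * z) * b    ≡⟨ balance ⟩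
        (Y + q * Z) * b + e * z * a              ≡⟨ cong (λ t → t * b + e * z * a) (sym T≡) ⟩
        (y + q * z + δ) * b + e * z * a          ≡⟨ arrange (y + q * z) δ b (e * z * a) ⟩
        b * δ + e * z * a + (y + q * z) * b      ∎)
        where
        arrange : ∀ t δ b u → (t + δ) * b + u ≡ b * δ + u + t * b
        arrange = solve-∀

      above : ∀ δ → Y + q * Z + δ ≡ y + q * z → (suc x + e * Z) * a + b * δ ≡ e * z * a
      above δ t≡ = +-cancelʳ-≡ ((Y + q * Z) * b) _ _ (begin
        (suc x + e * Z) * a + b * δ + (Y + q * Z) * b  ≡⟨ arrange ((suc x + e * Z) * a) b δ (Y + q * Z) ⟩
        (suc x + e * Z) * a + (Y + q * Z + δ) * b      ≡⟨ cong (λ t → (suc x + e * Z) * a + t * b) t≡ ⟩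
        (suc x + e * Z) * a + (y + q * z) * b          ≡⟨ balance ⟩
        (Y + q * Z) * b + e * z * a                    ≡⟨ +-comm ((Y + q * Z) * b) (e * z * a) ⟩
        e * z * a + (Y + q * Z) * b                    ∎)
        where
        arrange : ∀ u b δ T → u + b * δ + T * b ≡ u + (T + δ) * b
        arrange = solve-∀

      too-far : ∀ w → 0 < w → Y + q * Z + w * a ≡ y + q * z → suc x + e * Z + w * b ≡ e * z → ⊥
      -- Multiplying `x≡` by `q` and adding `e * y` turns the right side into e t. After
      -- cancellation e Y equals q (x + 1) + (w + 1) c + e y, which is at least c + q.
      too-far (suc w) _ t≡ x≡ = <⇒≱ eY<c+q (+-cancelʳ-≤ (e * (q * Z + suc w * a)) _ _
        (≤-trans (m≤m+n _ (w * c + q * x + e * y)) (≤-reflexive (begin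
          c + q + e * (q * Z + suc w * a) + (w * c + q * x + e * y)
            ≡⟨ arrange₁ c q e Z w a x y ⟩
          q * (suc x + e * Z) + suc w * (c + e * a) + e * y
            ≡⟨ cong (λ t → q * (suc x + e * Z) + suc w * t + e * y) c+ea≡qb ⟩
          q * (suc x + e * Z) + suc w * (q * b) + e * y
            ≡⟨ arrange₂ q (suc x + e * Z) (suc w) b (e * y) ⟩
          q * (suc x + e * Z + suc w * b) + e * y
            ≡⟨ cong (λ t → q * t + e * y) x≡ ⟩
          q * (e * z) + e * y
            ≡⟨ arrange₃ q e z y ⟩
          e * (y + q * z)
            ≡⟨ cong (e *_) (sym t≡) ⟩
          e * (Y + q * Z + suc w * a)
            ≡⟨ arrange₄ e Y (q * Z) (suc w * a) ⟩
          e * Y + e * (q * Z + suc w * a) ∎))))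
        where
        arrange₁ : ∀ c q e Z w a x y → c + q + e * (q * Z + suc w * a) + (w * c + q * x + e * y)
                   ≡ q * (suc x + e * Z) + suc w * (c + e * a) + e * y
        arrange₁ = solve-∀
        arrange₂ : ∀ q u w b v → q * u + w * (q * b) + v ≡ q * (u + w * b) + v
        arrange₂ = solve-∀
        arrange₃ : ∀ q e z y → q * (e * z) + e * y ≡ e * (y + q * z)
        arrange₃ = solve-∀
        arrange₄ : ∀ e Y u v → e * (Y + u + v) ≡ e * Y + e * (u + v)
        arrange₄ = solve-∀

      by-sign : y + q * z ≤ Y + q * Z ⊎ Y + q * Z < y + q * z → ∃ λ w → Class Y Z (x ∷ y ∷ z ∷ []) w z
      -- All other terms are multiples of `a`, so `a` divides `b * δ`, and by coprimality the gap
      -- `δ`.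
      by-sign (inj₁ t≤T) with δ , T≡ ← m≤n⇒∃[o]m+o≡n t≤T
        with coprime-divisor {o = δ} coprime-ab (∣m+n∣m⇒∣n {m = e * z * a}
               (divides (suc x + e * Z) (trans (+-comm (e * z * a) _) (sym (below δ T≡)))) (divides (e * z) refl))
      ... | divides w refl = w , class refl T≡
        (*-cancelʳ-≡ _ _ a (trans (below δ T≡) (arrange b w a (e * z))))
        where
        arrange : ∀ b w a u → b * (w * a) + u * a ≡ (w * b + u) * a
        arrange = solve-∀
      by-sign (inj₂ T<t) with δ , t≡ ← m≤n⇒∃[o]m+o≡n (<⇒≤ T<t)
        with coprime-divisor {o = δ} coprime-ab (∣m+n∣m⇒∣n {m = (suc x + e * Z) * a}
               (divides (e * z) (above δ t≡)) (divides (suc x + e * Z) refl))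
      ... | divides zero    refl = ⊥-elim (<-irrefl (trans (sym (+-identityʳ _)) t≡) T<t)
      ... | divides (suc w) refl = ⊥-elim (too-far (suc w) z<s t≡
        (*-cancelʳ-≡ _ _ a (trans (arrange (suc x + e * Z) (suc w) b a) (above (suc w * a) t≡))))
        where
        arrange : ∀ u w b a → (u + w * b) * a ≡ u * a + b * (w * a)
        arrange = solve-∀

    d≤length-classes : ∀ {Y Z g} cs → Y * b + Z * c ≡ g + a → e * Y < c + q →
                    (∀ {v w z} → Class Y Z v w z → (w , z) ∈ cs) → d (+ g) generators ≤ length cs
    d≤length-classes {Y} {Z} {g} cs G≡ eY<c+q complete = length-≤-by-injection
      (λ v (w , z) → Class Y Z v w z) (solutions-unique (+ g) generators) total class-injective
      where
      arrange : ∀ x a y b z c → suc x * a + (y * b + z * c) ≡ a * x + (b * y + (c * z + 0)) + a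
      arrange = solve-∀

      total : ∀ {v} → v ∈ solutions (+ g) generators → ∃ λ p → p ∈ cs × Class Y Z v (proj₁ p) (proj₂ p)
      total {v@(x ∷ y ∷ z ∷ [])} v∈ = (proj₁ C , z) , complete (proj₂ C) , proj₂ C
        where
        dot≡g = Equivalence.to (∈-solutions (+ g) generators v generators-nonZero) v∈
        C = classify Y Z eY<c+q x y z (trans (arrange x a y b z c)
              (trans (cong (_+ a) (ℤ.+-injective dot≡g)) (sym G≡)))

    a≤weight : ∀ Y Z → 0 < Y + Z → a ≤ Y * b + Z * c
    a≤weight (suc Y) Z       _ = ≤-trans a≤b (m≤n⇒m≤n+o _ (m≤m+n b _))
    a≤weight zero    (suc Z) _ = ≤-trans a≤c (m≤m+n c _)

    -- `0 < Y + Z` makes the weight at least `a`, so the claimed value is a natural number and only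
    -- nonnegative n can exceed it. The list `cs` has only to contain every class that occurs, so an
    -- upper bound for the number of representations suffices.
    isFrobeniusNumber : ∀ {p} Y Z → 0 < Y + Z → e * Y ≤ c →
      (∀ s → s < a → Lights (suc p) Y Z s) →
      (∃ λ cs → length cs ≡ p × (∀ {v w z} → Class Y Z v w z → (w , z) ∈ cs)) →
      IsFrobeniusNumber p generators (+ Y ℤ.* + b ℤ.+ + Z ℤ.* + c ℤ.- + a)
    isFrobeniusNumber Y Z 0<Y+Z eY≤c lights (cs , refl , complete)
      with g , G≡ ← m≤n⇒∃[o]m+o≡n (a≤weight Y Z 0<Y+Z)
      = subst (IsFrobeniusNumber _ generators) (sym g≡) (record
      { positive = generators-nonZero
      ; coprime  = generators-coprime
      ; few      = d≤length-classes cs (trans (sym G≡) (+-comm a g)) (≤-<-trans eY≤c (m<m+n c 0<q)) complete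
      ; largest  = λ n d≤p → ℤ.≮⇒≥ (many n d≤p)
      })
      where
      g≡ : + Y ℤ.* + b ℤ.+ + Z ℤ.* + c ℤ.- + a ≡ + g
      g≡ = begin
        + Y ℤ.* + b ℤ.+ + Z ℤ.* + c ℤ.- + a    ≡⟨ cong₂ (λ u v → u ℤ.+ v ℤ.- + a) (sym (ℤ.pos-* Y b)) (sym (ℤ.pos-* Z c)) ⟩
        + (Y * b + Z * c) ℤ.- + a              ≡⟨ cong (λ t → + t ℤ.- + a) (sym G≡) ⟩
        + (a + g) ℤ.- + a                      ≡⟨ ℤ.m-n≡m⊖n (a + g) a ⟩
        a + g ℤ.⊖ a                            ≡⟨ ℤ.⊖-≥ (m≤m+n a g) ⟩
        + (a + g ∸ a)                          ≡⟨ cong +_ (m+n∸m≡n a g) ⟩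
        + g                                    ∎
        where open ≡-Reasoning
      many : ∀ n → d n generators ≤ length cs → + g ℤ.< n → ⊥
      many (+ n) d≤p (ℤ.+<+ g<n)
        with s , s<a , k , l , n≡ ← residue coprime-ab n
        with ps , len , unique , all-light ← lights s s<a
        = <⇒≱ (≤-reflexive (sym len)) (≤-trans (length-light≤d {k = k} {l} (trans (sym G≡) (+-comm a g)) g<n n≡ unique all-light) d≤p)

    -- Supplying light pairs

    light-at : ∀ {Y Z s y z} j → y + q * z ≡ s + j * a → y ≤ Y → z ≤ Z → Light Y Z s (y , z)
    light-at j t≡ y≤Y z≤Z = light j t≡ (+-mono-≤ (*-monoˡ-≤ b y≤Y) (*-monoˡ-≤ c z≤Z))

    light₀ : ∀ {Y Z s} → s ≤ Y → Light Y Z s (s , 0)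
    light₀ {s = s} s≤Y = light-at 0 (cong (λ t → s + t) (*-zeroʳ q)) s≤Y z≤n

    light₁ : ∀ {Y Z s} → s + a ≤ Y → Light Y Z s (s + a , 0)
    light₁ {s = s} s+a≤Y = light-at 1 (trans (cong (λ t → s + a + t) (*-zeroʳ q)) (+-assoc s a 0)) s+a≤Y z≤n

    light₂ : ∀ {Y Z s} → s + a + a ≤ Y → Light Y Z s (s + a + a , 0)
    light₂ {s = s} s+2a≤Y = light-at 2
      (trans (cong (λ t → s + a + a + t) (*-zeroʳ q)) (trans (+-assoc (s + a) a 0) (+-assoc s a (a + 0)))) s+2a≤Y z≤n

    raise-≢ : ∀ {y z z′ : ℕ} → (y , z) ≢ (y + a , z′)
    raise-≢ {y} eq = m≢1+m+n y (trans (cong proj₁ eq) (trans (cong (λ t → y + t) (sym (suc-pred a))) (+-suc y (pred a))))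

    three : ∀ {Y Z s p₁ p₂ p₃} → Light Y Z s p₁ → Light Y Z s p₂ → Light Y Z s p₃ →
            p₁ ≢ p₂ → p₁ ≢ p₃ → p₂ ≢ p₃ → Lights 3 Y Z s
    three l₁ l₂ l₃ ≢₁₂ ≢₁₃ ≢₂₃ =
      _ , refl , (≢₁₂ ∷ ≢₁₃ ∷ []) ∷ (≢₂₃ ∷ []) ∷ [] ∷ [] , l₁ ∷ l₂ ∷ l₃ ∷ []

    light-≤ : ∀ {Y Z Y′ Z′ s p} → Y * b + Z * c ≤ Y′ * b + Z′ * c → Light Y Z s p → Light Y′ Z′ s p
    light-≤ G≤G′ (light j y-eq weight) = light j y-eq (≤-trans weight G≤G′)

    lights-≤ : ∀ {p Y Z Y′ Z′ s} → Y * b + Z * c ≤ Y′ * b + Z′ * c → Lights p Y Z s → Lights p Y′ Z′ s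
    lights-≤ G≤G′ (ps , len , unique , all-light) =
      ps , len , unique , ListAll.map (light-≤ G≤G′) all-light

    -- The candidates have y one below a natural quantity such as `q`, `h` or `2 * a`; adding `b`
    -- restores that quantity and lets c + e a = q b be applied.
    weight-≤ : ∀ Y Z Y′ Z′ → suc Y * b + Z * c ≤ suc Y′ * b + Z′ * c → Y * b + Z * c ≤ Y′ * b + Z′ * c
    weight-≤ Y Z Y′ Z′ le = +-cancelˡ-≤ b _ _
      (subst₂ _≤_ (+-assoc b (Y * b) (Z * c)) (+-assoc b (Y′ * b) (Z′ * c)) le)

    -- The pair `(s , 0)` is lighter than `(s + a , 0)`, and a positive second entry separates the
    -- third pair from both.
    three₀₁ : ∀ {Y Z s y z} → Light Y Z s (s + a , 0) → Light Y Z s (y , suc z) → Lights 3 Y Z s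
    three₀₁ {Y} {Z} {s} l₁ l = three l₀ l₁ l raise-≢ (λ ()) (λ ())
      where
      l₀ : Light Y Z s (s , 0)
      l₀ = light 0 (cong (λ t → s + t) (*-zeroʳ q))
             (≤-trans (+-monoˡ-≤ 0 (*-monoˡ-≤ b (m≤m+n s a))) (Light.weight l₁))

    three₀₁₂ : ∀ {Y Z s} → s + a + a ≤ Y → Lights 3 Y Z s
    three₀₁₂ {Y} {Z} {s} s+2a≤Y =
      three (light₀ s≤Y) (light₁ s+a≤Y) (light₂ s+2a≤Y)
        raise-≢ (λ eq → m≢1+m+n s (trans (cong proj₁ eq) s+2a≡)) raise-≢
      where
      s+a≤Y = ≤-trans (m≤m+n (s + a) a) s+2a≤Y
      s≤Y = ≤-trans (m≤m+n s a) s+a≤Y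
      s+2a≡ : s + a + a ≡ suc (s + (pred a + a))
      s+2a≡ = trans (+-assoc s a a)
        (trans (cong (λ t → s + (t + a)) (sym (suc-pred a))) (+-suc s (pred a + a)))

    -- Excluding all but two classes

    class-bound : ∀ {Y Z v w z} w₀ z₀ → Class Y Z v w z → w₀ ≤ w → z₀ ≤ z → q * z₀ + w₀ * a ≤ Y + q * Z
    class-bound w₀ z₀ (class {y = y} _ y-eq _) w₀≤w z₀≤z = subst (q * z₀ + w₀ * a ≤_) y-eq
      (+-mono-≤ (≤-trans (*-monoʳ-≤ q z₀≤z) (m≤n+m _ y)) (*-monoˡ-≤ a w₀≤w))

    class-w≡0 : ∀ {Y Z v z} → Class Y Z v 0 z → Z < z
    class-w≡0 {Z = Z} {z = z} (class {x} _ _ x-eq) = *-cancelˡ-< e Z z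
      (≤-trans (s≤s (m≤n+m (e * Z) x)) (≤-reflexive x-eq))

    -- With w = 0 positivity of x + 1 forces z > Z, but q (Z + 1) is already beyond T = Y + q Z.
    class-w≢0 : ∀ {Y Z v z} → Y < q → Class Y Z v 0 z → ⊥
    class-w≢0 {Y} {Z} Y<q C = <⇒≱ (+-monoˡ-< (q * Z) Y<q)
      (≤-trans (≤-reflexive (trans (sym (*-suc q Z)) (sym (+-identityʳ (q * suc Z)))))
        (class-bound 0 (suc Z) C z≤n (class-w≡0 C)))

    Classes : ℕ → ℕ → List (ℕ × ℕ) → Set
    Classes Y Z cs = ∀ {v w z} → Class Y Z v w z → (w , z) ∈ cs

    -- The subscript lists the surviving (w, z). Each hypothesis forbids a corner (w₀, z₀) and
    -- everything above it, in the shape `q * z₀ + w₀ * a` of `class-bound`: here (1, 1) and (3, 0).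
    classes₁₀₂₀ : ∀ {Y Z} → Y < q → Y + q * Z < q * 1 + 1 * a → Y + q * Z < q * 0 + 3 * a →
                  Classes Y Z ((1 , 0) ∷ (2 , 0) ∷ [])
    classes₁₀₂₀ Y<q T<q+a T<3a {w = 0} C = ⊥-elim (class-w≢0 Y<q C)
    classes₁₀₂₀ Y<q T<q+a T<3a {w = suc w} {suc z} C = ⊥-elim (<⇒≱ T<q+a (class-bound 1 1 C (s≤s z≤n) (s≤s z≤n)))
    classes₁₀₂₀ Y<q T<q+a T<3a {w = 1} {0} C = here refl
    classes₁₀₂₀ Y<q T<q+a T<3a {w = 2} {0} C = there (here refl)
    classes₁₀₂₀ Y<q T<q+a T<3a {w = suc (suc (suc w))} {0} C =
      ⊥-elim (<⇒≱ T<3a (class-bound 3 0 C (s≤s (s≤s (s≤s z≤n))) z≤n))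

    classes₁₀₁₁ : ∀ {Y Z} → Y < q → Y + q * Z < q * 2 + 1 * a → Y + q * Z < q * 0 + 2 * a →
                  Classes Y Z ((1 , 0) ∷ (1 , 1) ∷ [])
    classes₁₀₁₁ Y<q T<2q+a T<2a {w = 0} C = ⊥-elim (class-w≢0 Y<q C)
    classes₁₀₁₁ Y<q T<2q+a T<2a {w = 1} {0} C = here refl
    classes₁₀₁₁ Y<q T<2q+a T<2a {w = 1} {1} C = there (here refl)
    classes₁₀₁₁ Y<q T<2q+a T<2a {w = 1} {suc (suc z)} C =
      ⊥-elim (<⇒≱ T<2q+a (class-bound 1 2 C (s≤s z≤n) (s≤s (s≤s z≤n))))
    classes₁₀₁₁ Y<q T<2q+a T<2a {w = suc (suc w)} C =
      ⊥-elim (<⇒≱ T<2a (class-bound 2 0 C (s≤s (s≤s z≤n)) z≤n))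

    -- For (d), where Y = 2 a - 1 is at least q = a: now w = 0 can occur, with z = 1.
    classes₁₀₀₁ : ∀ {Y} → Y + q * 0 < q * 0 + 2 * a → Y + q * 0 < q * 1 + 1 * a → Y + q * 0 < q * 2 + 0 * a →
                  Classes Y 0 ((1 , 0) ∷ (0 , 1) ∷ [])
    classes₁₀₀₁ T<2a T<q+a T<2q {w = 0} {0} C = ⊥-elim (<⇒≱ (class-w≡0 C) z≤n)
    classes₁₀₀₁ T<2a T<q+a T<2q {w = 0} {1} C = there (here refl)
    classes₁₀₀₁ T<2a T<q+a T<2q {w = 0} {suc (suc z)} C = ⊥-elim (<⇒≱ T<2q (class-bound 0 2 C z≤n (s≤s (s≤s z≤n))))
    classes₁₀₀₁ T<2a T<q+a T<2q {w = 1} {0} C = here refl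
    classes₁₀₀₁ T<2a T<q+a T<2q {w = suc w} {suc z} C = ⊥-elim (<⇒≱ T<q+a (class-bound 1 1 C (s≤s z≤n) (s≤s z≤n)))
    classes₁₀₀₁ T<2a T<q+a T<2q {w = suc (suc w)} {0} C = ⊥-elim (<⇒≱ T<2a (class-bound 2 0 C (s≤s (s≤s z≤n)) z≤n))

  open ≤-Reasoning

  -- Parts (a) to (d), where q ≥ a

  slack : ∀ {m n} o → m + o ≡ n → m ≤ n
  slack {m} o eq = m+n≤o⇒m≤o m (≤-reflexive eq)

  module _ {a b c q e Y : ℕ} (3a≡ : suc Y ≡ 3 * a) (3a≤q : 3 * a ≤ q) (2a≤b : 2 * a ≤ b) (2e≤q : 2 * e ≤ q)
    (c+ea≡qb : c + e * a ≡ q * b) (coprime-ab : Coprime a b)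
    (0<a : 0 < a) (0<q : 0 < q) (a≤b : a ≤ b) (a≤c : a ≤ c) where

    open Criterion a b c q e c+ea≡qb coprime-ab 0<a 0<q a≤b a≤c

    -- No t below 3 a reaches `q`, so s + 2 a is realised by y alone; the last residue s = a - 1
    -- gives Y = 3 a - 1.
    frobenius-a : IsFrobeniusNumber 2 generators (+ Y ℤ.* + b ℤ.+ + 0 ℤ.* + c ℤ.- + a)
    frobenius-a = isFrobeniusNumber Y 0 (≤-trans 0<Y (m≤m+n Y 0)) eY≤c lights
      (_ , refl , classes₁₀₂₀ Y<q
        (≤-<-trans (≤-reflexive T≡Y) (<-≤-trans Y<q (slack (1 * a) (cong (λ t → t + 1 * a) (sym (*-identityʳ q))))))
        (≤-<-trans (≤-reflexive T≡Y) (≤-trans (≤-reflexive 3a≡) (m≤n+m (3 * a) (q * 0)))))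
      where
      0<Y : 0 < Y
      0<Y = s<s⁻¹ (≤-trans (≤-trans (s≤s (s≤s z≤n)) (*-monoʳ-≤ 3 0<a)) (≤-reflexive (sym 3a≡)))

      Y<q : Y < q
      Y<q = ≤-trans (≤-reflexive 3a≡) 3a≤q

      T≡Y : Y + q * 0 ≡ Y
      T≡Y = trans (cong (λ t → Y + t) (*-zeroʳ q)) (+-identityʳ Y)

      eY≤c : e * Y ≤ c
      eY≤c = +-cancelʳ-≤ (e * a) (e * Y) c (begin
        e * Y + e * a          ≤⟨ +-monoˡ-≤ (e * a) (*-monoʳ-≤ e (n≤1+n Y)) ⟩
        e * suc Y + e * a      ≡⟨ cong (λ t → e * t + e * a) 3a≡ ⟩
        e * (3 * a) + e * a    ≡⟨ arrange e a ⟩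
        2 * e * (2 * a)        ≤⟨ *-mono-≤ 2e≤q 2a≤b ⟩
        q * b                  ≡⟨ sym c+ea≡qb ⟩
        c + e * a              ∎)
        where
        arrange : ∀ e a → e * (3 * a) + e * a ≡ 2 * e * (2 * a)
        arrange = solve-∀

      lights : ∀ s → s < a → Lights 3 Y 0 s
      lights s s<a = three₀₁₂ (s≤s⁻¹ (begin
        suc s + a + a   ≤⟨ +-monoˡ-≤ a (+-monoˡ-≤ a s<a) ⟩
        a + a + a       ≡⟨ arrange a ⟩
        3 * a           ≡⟨ sym 3a≡ ⟩
        suc Y           ∎))
        where
        arrange : ∀ a → a + a + a ≡ 3 * a
        arrange = solve-∀

  -- a, b, h and f play F i, F (i + 2), F (i - 2) and F (i - 1); b is written so
  -- that this holds by unfolding F.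
  module Consecutive (f h : ℕ) (0<f : 0 < f) (0<h : 0 < h) (h≤f : h ≤ f) where

    a b : ℕ
    a = f + h
    b = a + f + a

    0<a : 0 < a
    0<a = <-≤-trans 0<f (m≤m+n f h)

    0<b : 0 < b
    0<b = <-≤-trans 0<a (m≤n+m a (a + f))

    a≤b : a ≤ b
    a≤b = m≤n+m a (a + f)

    module _ {c : ℕ} (c+aa≡bb : c + a * a ≡ b * b) (coprime-ab : Coprime a b) (a≤c : a ≤ c) where

      open Criterion a b c b a c+aa≡bb coprime-ab 0<a 0<b a≤b a≤c

      private
        aY≤c : ∀ {Y} → Y < b → a * Y ≤ c
        aY≤c {Y} Y<b = ≤-trans (*-monoʳ-≤ a (<⇒≤ Y<b)) (+-cancelʳ-≤ (a * a) (a * b) c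
          (≤-trans (slack (a * (a + f) + f * b) (arrange f h)) (≤-reflexive (sym c+aa≡bb))))
          where
          arrange : ∀ f h → (f + h) * (f + h + f + (f + h)) + (f + h) * (f + h) + ((f + h) * (f + h + f) + f * (f + h + f + (f + h)))
                    ≡ (f + h + f + (f + h)) * (f + h + f + (f + h))
          arrange = solve-∀

        -- Here q = b = 2 a + f. For s < f the number s + 2 a stays below `q` and is used with z =
        -- 0; from s = f on it becomes the pair (s - f, 1) with s - f < h. The ends of the two
        -- ranges are the candidates (b - 1, 0) and (h - 1, 1).
        lights : ∀ {B H Y Z} → suc B ≡ b → suc H ≡ h →
                 B * b + 0 * c ≤ Y * b + Z * c → H * b + 1 * c ≤ Y * b + Z * c →
                 ∀ s → s < a → Lights 3 Y Z s
        lights {B} {H} {Y} {Z} B≡ H≡ le-B le-H s s<a with <-≤-connex s f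
        ... | inj₁ s<f = lights-≤ {Y = B} {0} {Y} {Z} le-B (three₀₁₂ {B} {0} {s} (s≤s⁻¹ (begin
              suc s + a + a     ≤⟨ +-monoˡ-≤ a (+-monoˡ-≤ a s<f) ⟩
              f + a + a         ≡⟨ cong (λ t → t + a) (+-comm f a) ⟩
              b                 ≡⟨ sym B≡ ⟩
              suc B             ∎)))
        ... | inj₂ f≤s with o , refl ← m≤n⇒∃[o]m+o≡n f≤s =
          three₀₁ (light-≤ le-B (light₁ {Z = 0} (s≤s⁻¹ (begin
              suc (f + o) + a    ≤⟨ +-monoˡ-≤ a s<a ⟩
              a + a              ≤⟨ +-monoˡ-≤ a (m≤m+n a f) ⟩
              b                  ≡⟨ sym B≡ ⟩
              suc B              ∎))))
            (light-≤ le-H (light-at 2 (arrange f h o)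
              (s≤s⁻¹ (≤-trans (+-cancelˡ-< f o h s<a) (≤-reflexive (sym H≡)))) ≤-refl))
          where
          arrange : ∀ f h o → o + (f + h + f + (f + h)) * 1 ≡ f + o + 2 * (f + h)
          arrange = solve-∀

      -- Since b b - c = a a, the candidate (b - 1, 0) is the heavier one when h b ≤ a a, and
      -- cancelling 2 f h + h h leaves exactly the second hypothesis.
      frobenius-b-even : ∀ {Y} → suc Y ≡ b → f * h + h * h ≤ f * f →
        IsFrobeniusNumber 2 generators (+ Y ℤ.* + b ℤ.+ + 0 ℤ.* + c ℤ.- + a)
      frobenius-b-even {Y} Y≡ le = isFrobeniusNumber Y 0 0<Y+0 (aY≤c (≤-reflexive Y≡))
        (lights Y≡ (suc-pred h) ≤-refl (weight-≤ (pred h) 1 Y 0 bounds-b))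
        (_ , refl , classes₁₀₂₀ (≤-reflexive Y≡)
          (≤-trans (≤-reflexive T≡) (slack a (arrange₃ b a)))
          (≤-trans (≤-reflexive T≡) (slack h (arrange₄ f h))))
        where
        instance h≢0 = >-nonZero 0<h
        0<Y+0 : 0 < Y + 0
        0<Y+0 = ≤-trans (s<s⁻¹ (≤-trans (+-mono-≤ (≤-trans 0<a (m≤m+n a f)) 0<a) (≤-reflexive (sym Y≡)))) (m≤m+n Y 0)
        T≡ : suc (Y + b * 0) ≡ b
        T≡ = trans (cong suc (trans (cong (λ t → Y + t) (*-zeroʳ b)) (+-identityʳ Y))) Y≡
        arrange₁ : ∀ h b c a → h * b + 1 * c + a * a ≡ c + a * a + h * b
        arrange₁ = solve-∀
        arrange₂ : ∀ f h → h * (f + h + f + (f + h)) ≡ f * h + h * h + (2 * (f * h) + h * h)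
        arrange₂ = solve-∀
        arrange₂′ : ∀ f h → f * f + (2 * (f * h) + h * h) ≡ (f + h) * (f + h)
        arrange₂′ = solve-∀
        arrange₃ : ∀ b a → b + a ≡ b * 1 + 1 * a
        arrange₃ = solve-∀
        arrange₄ : ∀ f h → f + h + f + (f + h) + h ≡ (f + h + f + (f + h)) * 0 + 3 * (f + h)
        arrange₄ = solve-∀
        bounds-b : suc (pred h) * b + 1 * c ≤ suc Y * b + 0 * c
        bounds-b = +-cancelʳ-≤ (a * a) _ _ (begin
          suc (pred h) * b + 1 * c + a * a         ≡⟨ cong (λ t → t * b + 1 * c + a * a) (suc-pred h) ⟩
          h * b + 1 * c + a * a                    ≡⟨ arrange₁ h b c a ⟩
          c + a * a + h * b                        ≡⟨ cong (λ t → t + h * b) c+aa≡bb ⟩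
          b * b + h * b                            ≡⟨ cong (λ t → b * b + t) (arrange₂ f h) ⟩
          b * b + (f * h + h * h + (2 * (f * h) + h * h))  ≤⟨ +-monoʳ-≤ (b * b) (+-monoˡ-≤ _ le) ⟩
          b * b + (f * f + (2 * (f * h) + h * h))  ≡⟨ cong (λ t → b * b + t) (arrange₂′ f h) ⟩
          b * b + a * a                            ≡⟨ cong (λ t → t * b + a * a) (sym Y≡) ⟩
          suc Y * b + a * a                        ≡⟨ cong (λ t → t + a * a) (sym (+-identityʳ (suc Y * b))) ⟩
          suc Y * b + 0 * c + a * a                ∎)

      -- The opposite sign makes (h - 1, 1) the heavier candidate. Now T + 1 = h + b = 3 a, so the
      -- class (3, 0) is excluded by a margin of one.
      frobenius-b-odd : ∀ {Y} → suc Y ≡ h → f * f ≤ f * h + h * h →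
        IsFrobeniusNumber 2 generators (+ Y ℤ.* + b ℤ.+ + 1 ℤ.* + c ℤ.- + a)
      frobenius-b-odd {Y} Y≡ le = isFrobeniusNumber Y 1 (m≤n+m 1 Y) (aY≤c Y<b)
        (lights (suc-pred b) Y≡ (weight-≤ (pred b) 0 Y 1 bounds-b) ≤-refl)
        (_ , refl , classes₁₀₂₀ Y<b
          (≤-trans (+-monoˡ-≤ (b * 1) (≤-trans (≤-reflexive Y≡) (m≤n+m h f))) (≤-reflexive (arrange₃ a b)))
          (≤-trans (+-monoˡ-≤ (b * 1) (≤-reflexive Y≡)) (≤-reflexive (arrange₄ f h))))
        where
        instance b≢0 = >-nonZero 0<b
        Y<b : Y < b
        Y<b = ≤-trans (≤-reflexive Y≡) (≤-trans (m≤n+m h f) a≤b)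
        arrange₁ : ∀ h b c a → c + a * a + h * b ≡ h * b + 1 * c + a * a
        arrange₁ = solve-∀
        arrange₂ : ∀ f h → (f + h) * (f + h) ≡ f * f + (2 * (f * h) + h * h)
        arrange₂ = solve-∀
        arrange₂′ : ∀ f h → f * h + h * h + (2 * (f * h) + h * h) ≡ h * (f + h + f + (f + h))
        arrange₂′ = solve-∀
        arrange₃ : ∀ a b → a + b * 1 ≡ b * 1 + 1 * a
        arrange₃ = solve-∀
        arrange₄ : ∀ f h → h + (f + h + f + (f + h)) * 1 ≡ (f + h + f + (f + h)) * 0 + 3 * (f + h)
        arrange₄ = solve-∀
        bounds-b : suc (pred b) * b + 0 * c ≤ suc Y * b + 1 * c
        bounds-b = +-cancelʳ-≤ (a * a) _ _ (begin
          suc (pred b) * b + 0 * c + a * a         ≡⟨ cong (λ t → t * b + 0 * c + a * a) (suc-pred b) ⟩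
          b * b + 0 * c + a * a                    ≡⟨ cong₂ _+_ (+-identityʳ (b * b)) (arrange₂ f h) ⟩
          b * b + (f * f + (2 * (f * h) + h * h))  ≤⟨ +-monoʳ-≤ (b * b) (+-monoˡ-≤ _ le) ⟩
          b * b + (f * h + h * h + (2 * (f * h) + h * h))  ≡⟨ cong (λ t → b * b + t) (arrange₂′ f h) ⟩
          b * b + h * b                            ≡⟨ cong (λ t → t + h * b) (sym c+aa≡bb) ⟩
          c + a * a + h * b                        ≡⟨ arrange₁ h b c a ⟩
          h * b + 1 * c + a * a                    ≡⟨ cong (λ t → t * b + 1 * c + a * a) (sym Y≡) ⟩
          suc Y * b + 1 * c + a * a                ∎)

    module _ {c : ℕ} (c+fa≡ : c + f * a ≡ (a + f) * b) (coprime-ab : Coprime a b) (a≤c : a ≤ c) where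

      open Criterion a b c (a + f) f c+fa≡ coprime-ab 0<a (<-≤-trans 0<a (m≤m+n a f)) a≤b a≤c

      private
        ab≤c : a * b ≤ c
        ab≤c = +-cancelʳ-≤ (f * a) (a * b) c (≤-trans
          (slack (f * (a + f)) (arrange f h)) (≤-reflexive (sym c+fa≡)))
          where
          arrange : ∀ f h → (f + h) * (f + h + f + (f + h)) + f * (f + h) + f * (f + h + f)
                    ≡ (f + h + f) * (f + h + f + (f + h))
          arrange = solve-∀

      -- As q = a + f < 2 a, one z always fits into s + 2 a, leaving y = s + h, and it fits into s +
      -- a once s ≥ f. The former is needed only for s < f, where y ≤ a - 1; this gives Y. The pair
      -- `(s + a , 0)` stays within the bound because a b ≤ c.
      frobenius-c : ∀ {Y} → suc Y ≡ a →
        IsFrobeniusNumber 2 generators (+ Y ℤ.* + b ℤ.+ + 1 ℤ.* + c ℤ.- + a)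
      frobenius-c {Y} Y≡ = isFrobeniusNumber Y 1 (m≤n+m 1 Y)
        (≤-trans (*-mono-≤ (m≤m+n f h) (≤-trans (n≤1+n Y) (≤-trans (≤-reflexive Y≡) a≤b))) ab≤c)
        lights
        (_ , refl , classes₁₀₂₀ Y<q
          (≤-trans (+-monoˡ-≤ ((a + f) * 1) (≤-reflexive Y≡)) (≤-reflexive (arrange₁ a f)))
          (≤-trans (+-monoˡ-≤ ((a + f) * 1) (≤-reflexive Y≡)) (slack h (arrange₂ f h))))
        where
        Y<q : Y < a + f
        Y<q = ≤-trans (≤-reflexive Y≡) (m≤m+n a f)
        arrange₁ : ∀ a f → a + (a + f) * 1 ≡ (a + f) * 1 + 1 * a
        arrange₁ = solve-∀
        arrange₂ : ∀ f h → f + h + (f + h + f) * 1 + h ≡ (f + h + f) * 0 + 3 * (f + h)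
        arrange₂ = solve-∀
        arrange₃ : ∀ a b → (a + a) * b + 0 ≡ a * b + a * b
        arrange₃ = solve-∀
        arrange₄ : ∀ f h s → s + h + (f + h + f) * 1 ≡ s + 2 * (f + h)
        arrange₄ = solve-∀
        arrange₅ : ∀ f h o → o + (f + h + f) * 1 ≡ f + o + 1 * (f + h)
        arrange₅ = solve-∀

        second : ∀ {s} → s < a → Light Y 1 s (s + a , 0)
        second {s} s<a = light-≤ (weight-≤ (s + a) 0 Y 1 (begin
            suc (s + a) * b + 0      ≤⟨ +-monoˡ-≤ 0 (*-monoˡ-≤ b (+-monoˡ-≤ a s<a)) ⟩
            (a + a) * b + 0          ≡⟨ arrange₃ a b ⟩
            a * b + a * b            ≤⟨ +-monoʳ-≤ (a * b) ab≤c ⟩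
            a * b + c                ≡⟨ cong₂ (λ t u → t * b + u) (sym Y≡) (sym (+-identityʳ c)) ⟩
            suc Y * b + 1 * c        ∎))
          (light₁ {Z = 0} ≤-refl)

        lights : ∀ s → s < a → Lights 3 Y 1 s
        lights s s<a with <-≤-connex s f
        ... | inj₁ s<f = three₀₁ (second s<a) (light-at 2 (arrange₄ f h s)
          (s≤s⁻¹ (≤-trans (+-monoˡ-≤ h s<f) (≤-reflexive (sym Y≡)))) ≤-refl)
        ... | inj₂ f≤s with o , refl ← m≤n⇒∃[o]m+o≡n f≤s =
          three₀₁ (second s<a) (light-at 1 (arrange₅ f h o)
            (s≤s⁻¹ (≤-trans (s≤s (m≤n+m o f)) (≤-trans s<a (≤-reflexive (sym Y≡))))) ≤-refl)

    module _ {c : ℕ} (c+ha≡ab : c + h * a ≡ a * b) (coprime-ab : Coprime a b) (a≤c : a ≤ c) where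

      open Criterion a b c a h c+ha≡ab coprime-ab 0<a 0<a a≤b a≤c

      frobenius-d : ∀ {Y} → suc Y ≡ 2 * a →
        IsFrobeniusNumber 2 generators (+ Y ℤ.* + b ℤ.+ + 0 ℤ.* + c ℤ.- + a)
      frobenius-d {Y} Y≡ = isFrobeniusNumber Y 0 0<Y+0 hY≤c lights
        (_ , refl , classes₁₀₀₁
          (≤-trans (≤-reflexive T≡) (m≤n+m (2 * a) (a * 0)))
          (≤-reflexive (trans T≡ (arrange₂ a)))
          (≤-reflexive (trans T≡ (arrange₃ a))))
        where
        0<Y+0 : 0 < Y + 0
        0<Y+0 = ≤-trans (s<s⁻¹ (≤-trans (*-monoʳ-≤ 2 0<a) (≤-reflexive (sym Y≡)))) (m≤m+n Y 0)
        T≡ : suc (Y + a * 0) ≡ 2 * a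
        T≡ = trans (cong suc (trans (cong (λ t → Y + t) (*-zeroʳ a)) (+-identityʳ Y))) Y≡
        arrange₁ : ∀ a h → h * (2 * a) + h * a ≡ (h + h + h) * a
        arrange₁ = solve-∀
        arrange₂ : ∀ a → 2 * a ≡ a * 1 + 1 * a
        arrange₂ = solve-∀
        arrange₃ : ∀ a → 2 * a ≡ a * 2 + 0 * a
        arrange₃ = solve-∀
        arrange₄ : ∀ a → a + a ≡ 2 * a
        arrange₄ = solve-∀
        arrange₅ : ∀ a b → a * b + a * b ≡ 2 * a * b + 0
        arrange₅ = solve-∀
        c≤ab : c ≤ a * b
        c≤ab = m+n≤o⇒m≤o c (≤-reflexive c+ha≡ab)
        hY≤c : h * Y ≤ c
        hY≤c = +-cancelʳ-≤ (h * a) (h * Y) c (begin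
          h * Y + h * a          ≤⟨ +-monoˡ-≤ (h * a) (*-monoʳ-≤ h (≤-trans (n≤1+n Y) (≤-reflexive Y≡))) ⟩
          h * (2 * a) + h * a    ≡⟨ arrange₁ a h ⟩
          (h + h + h) * a        ≤⟨ *-monoˡ-≤ a (+-mono-≤ (+-mono-≤ (m≤n+m h f) h≤f) (m≤n+m h f)) ⟩
          b * a                  ≡⟨ *-comm b a ⟩
          a * b                  ≡⟨ sym c+ha≡ab ⟩
          c + h * a              ∎)

        lights : ∀ s → s < a → Lights 3 Y 0 s
        lights s s<a = three₀₁
          (light₁ (s≤s⁻¹ (≤-trans (+-monoˡ-≤ a s<a) (≤-reflexive (trans (arrange₄ a) (sym Y≡))))))
          (light 1 (cong (λ t → s + t) (trans (*-identityʳ a) (sym (+-identityʳ a))))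
            (weight-≤ s 1 Y 0 (begin
              suc s * b + 1 * c    ≤⟨ +-mono-≤ (*-monoˡ-≤ b s<a) (≤-trans (≤-reflexive (+-identityʳ c)) c≤ab) ⟩
              a * b + a * b        ≡⟨ arrange₅ a b ⟩
              2 * a * b + 0        ≡⟨ cong (λ t → t * b + 0) (sym Y≡) ⟩
              suc Y * b + 0 * c    ∎)))

  -- Parts (e) and (f), where q ≤ a

  quotRem : ∀ q → 0 < q → ∀ t → ∃₂ λ y z → y < q × y + q * z ≡ t
  quotRem (suc q) _ t = t % suc q , t / suc q , m%n<n t (suc q) ,
    sym (trans (m≡m%n+[m/n]*n t (suc q)) (cong (λ u → t % suc q + u) (*-comm (t / suc q) (suc q))))

  module SmallStep {a b c q e : ℕ} (c+ea≡qb : c + e * a ≡ q * b) (coprime-ab : Coprime a b)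
    (0<q : 0 < q) (q≤a : q ≤ a) (a≤b : a ≤ b) (a≤c : a ≤ c) (ea≤c : e * a ≤ c) where

    0<a : 0 < a
    0<a = ≤-trans 0<q q≤a

    open Criterion a b c q e c+ea≡qb coprime-ab 0<a 0<q a≤b a≤c

    eY≤c : ∀ {Y} → Y < q → e * Y ≤ c
    eY≤c Y<q = ≤-trans (*-monoʳ-≤ e (≤-trans (<⇒≤ Y<q) q≤a)) ea≤c

    distinct : ∀ {s y z y′ z′} → y + q * z ≡ s → y′ + q * z′ ≡ s + a → (y , z) ≢ (y′ , z′)
    distinct {s} t≡ t′≡ refl = <-irrefl (trans (sym t≡) t′≡) (m<m+n s 0<a)

    -- From q b = c + e a ≤ 2 c. Undoing one greedy exchange at t thus costs no more than the greedy
    -- pair at t + q, which reduces all estimates to greedy pairs.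
    lower : ∀ y z → (y + q) * b + z * c ≤ y * b + (2 + z) * c
    lower y z = begin
      (y + q) * b + z * c             ≡⟨ arrange₁ y q b z c ⟩
      q * b + (y * b + z * c)         ≡⟨ cong (λ t → t + (y * b + z * c)) (sym c+ea≡qb) ⟩
      c + e * a + (y * b + z * c)     ≤⟨ +-monoˡ-≤ _ (+-monoʳ-≤ c ea≤c) ⟩
      c + c + (y * b + z * c)         ≡⟨ arrange₂ c (y * b) z ⟩
      y * b + (2 + z) * c             ∎
      where
      arrange₁ : ∀ y q b z c → (y + q) * b + z * c ≡ q * b + (y * b + z * c)
      arrange₁ = solve-∀
      arrange₂ : ∀ c u z → c + c + (u + z * c) ≡ u + (2 + z) * c
      arrange₂ = solve-∀

    module _ {r H P : ℕ} (H≡ : suc H + r * q ≡ a) (P≡ : suc P ≡ q) (a≤ : a ≤ suc r * q) (2≤r : 2 ≤ r) where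

      private
        module _ {Y Z : ℕ} (le-H : H * b + (2 + r) * c ≤ Y * b + Z * c)
                           (le-P : P * b + suc r * c ≤ Y * b + Z * c) where

          -- Because a + 2 q = (H + 1) + (r + 2) q, a greedy pair below this number has n ≤ r + 1
          -- and y ≤ P, or n = r + 2 and y ≤ H. These are the two candidates.
          bound : ∀ y n → y < q → y + q * n < a + 2 * q → y * b + n * c ≤ Y * b + Z * c
          bound y n y<q t< with ≤-<-connex n (suc r)
          ... | inj₁ n≤ = ≤-trans
            (+-mono-≤ (*-monoˡ-≤ b (s≤s⁻¹ (≤-trans y<q (≤-reflexive (sym P≡))))) (*-monoˡ-≤ c n≤)) le-P
          ... | inj₂ n> with m≤n⇒∃[o]m+o≡n n>
          ...   | zero , refl = ≤-trans (+-mono-≤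
            (*-monoˡ-≤ b (s≤s⁻¹ (+-cancelʳ-< (r * q + 2 * q) y (suc H) (begin-strict
              y + (r * q + 2 * q)            ≡⟨ arrange y r q ⟩
              y + q * suc (suc (r + 0))      <⟨ t< ⟩
              a + 2 * q                      ≡⟨ cong (λ t → t + 2 * q) (sym H≡) ⟩
              suc H + r * q + 2 * q          ≡⟨ +-assoc (suc H) (r * q) (2 * q) ⟩
              suc H + (r * q + 2 * q)        ∎))))
            (≤-reflexive (cong (λ t → (2 + t) * c) (+-identityʳ r)))) le-H
            where
            arrange : ∀ y r q → y + (r * q + 2 * q) ≡ y + q * suc (suc (r + 0))
            arrange = solve-∀
          ...   | suc o , refl = ⊥-elim (<⇒≱ t< (begin
              a + 2 * q                                        ≤⟨ +-monoˡ-≤ (2 * q) a≤ ⟩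
              suc r * q + 2 * q                                ≤⟨ m≤m+n _ (y + q * o) ⟩
              suc r * q + 2 * q + (y + q * o)                  ≡⟨ arrange r q y o ⟩
              y + q * suc (suc (r + suc o))                    ∎))
            where
            arrange : ∀ r q y o → suc r * q + 2 * q + (y + q * o) ≡ y + q * suc (suc (r + suc o))
            arrange = solve-∀

          -- The number s itself offers one, two or at least three pairs according to s < q, q ≤ s <
          -- 2 q or 2 q ≤ s; missing ones come from s + a. Through `lower` each is bounded by a
          -- greedy pair at some t below a + 2 q.
          lights : ∀ s → s < a → Lights 3 Y Z s
          lights s s<a with <-≤-connex s q
          ... | inj₁ s<q = case (quotRem q 0<q (s + a))
            where
            case : (∃₂ λ y z → y < q × y + q * z ≡ s + a) → Lights 3 Y Z s
            case (y , zero , y<q , t≡) = ⊥-elim (<⇒≱ y<q (begin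
              q            ≤⟨ q≤a ⟩
              a            ≤⟨ m≤n+m a s ⟩
              s + a        ≡⟨ sym t≡ ⟩
              y + q * 0    ≡⟨ trans (cong (λ u → y + u) (*-zeroʳ q)) (+-identityʳ y) ⟩
              y            ∎))
            case (y , suc z , y<q , t≡) = three
              (light 0 (cong (λ u → s + u) (*-zeroʳ q))
                (bound s 0 s<q (≤-trans (s≤s (≤-reflexive s+q*0≡s)) (≤-trans s<a (m≤m+n a (2 * q))))))
              (light 1 (trans t≡ s+a≡)
                (bound y (suc z) y<q (≤-trans (s≤s (≤-reflexive t≡))
                  (≤-trans (+-monoˡ-< a s<q) (≤-trans (≤-reflexive (+-comm q a)) (+-monoʳ-≤ a (m≤m+n q (q + 0))))))))
              (light 1 (trans (trans (arrange₁ y q z) t≡) s+a≡)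
                (≤-trans (lower y z) (bound y (2 + z) y<q (begin-strict
                  y + q * (2 + z)        ≡⟨ arrange₂ y q z ⟩
                  y + q * suc z + q      ≡⟨ cong (λ u → u + q) t≡ ⟩
                  s + a + q              <⟨ +-monoˡ-< q (+-monoˡ-< a s<q) ⟩
                  q + a + q              ≡⟨ arrange₃ q a ⟩
                  a + 2 * q              ∎))))
              (distinct s+q*0≡s t≡)
              (distinct s+q*0≡s (trans (arrange₁ y q z) t≡))
              (λ eq → 1+n≢n (cong proj₂ eq))
              where
              s+q*0≡s = trans (cong (λ u → s + u) (*-zeroʳ q)) (+-identityʳ s)
              s+a≡ = cong (λ u → s + u) (sym (*-identityˡ a))
              arrange₁ : ∀ y q z → y + q + q * z ≡ y + q * suc z
              arrange₁ = solve-∀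
              arrange₂ : ∀ y q z → y + q * (2 + z) ≡ y + q * suc z + q
              arrange₂ = solve-∀
              arrange₃ : ∀ q a → q + a + q ≡ a + 2 * q
              arrange₃ = solve-∀
          ... | inj₂ q≤s with m≤n⇒∃[o]m+o≡n q≤s
          ...   | o , refl with <-≤-connex o q
          ...     | inj₁ o<q = case (quotRem q 0<q (q + o + a))
            where
            case : (∃₂ λ y z → y < q × y + q * z ≡ q + o + a) → Lights 3 Y Z (q + o)
            case (y , z , y<q , t≡) = three
              (light 0 (arrange₁ o q)
                (bound o 1 o<q (≤-trans (s≤s (≤-trans (≤-reflexive (arrange₁ o q)) (≤-reflexive (+-identityʳ (q + o)))))
                  (≤-trans s<a (m≤m+n a (2 * q))))))
              (light 0 (arrange₂ o q)
                (≤-trans (lower o 0) (bound o 2 o<q (≤-trans (s≤s (≤-reflexive (arrange₃ o q)))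
                  (≤-trans (+-monoˡ-< q s<a) (+-monoʳ-≤ a (m≤m+n q (q + 0))))))))
              (light 1 (trans t≡ (cong (λ u → q + o + u) (sym (*-identityˡ a))))
                (bound y z y<q (begin-strict
                  y + q * z     ≡⟨ t≡ ⟩
                  q + o + a     <⟨ +-monoˡ-< a (+-monoʳ-< q o<q) ⟩
                  q + q + a     ≡⟨ arrange₄ q a ⟩
                  a + 2 * q     ∎)))
              (λ ())
              (distinct (trans (arrange₁ o q) (+-identityʳ (q + o))) t≡)
              (distinct (trans (arrange₂ o q) (+-identityʳ (q + o))) t≡)
              where
              arrange₁ : ∀ o q → o + q * 1 ≡ q + o + 0
              arrange₁ = solve-∀
              arrange₂ : ∀ o q → o + q + q * 0 ≡ q + o + 0
              arrange₂ = solve-∀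
              arrange₃ : ∀ o q → o + q * 2 ≡ q + o + q
              arrange₃ = solve-∀
              arrange₄ : ∀ q a → q + q + a ≡ a + 2 * q
              arrange₄ = solve-∀
          ...     | inj₂ q≤o with m≤n⇒∃[o]m+o≡n q≤o
          ...       | u , refl with quotRem q 0<q u
          ...         | y , m , y<q , refl = three
              (light 0 (arrange₁ y m q)
                (bound y (2 + m) y<q (≤-<-trans (≤-reflexive (trans (arrange₁ y m q) (+-identityʳ _))) (<-≤-trans s<a (m≤m+n a (2 * q))))))
              (light 0 (arrange₂ y m q)
                (≤-trans (lower y (suc m)) (bound y (3 + m) y<q (≤-<-trans (≤-reflexive (arrange₄ y m q))
                  (<-≤-trans (+-monoˡ-< q s<a) (+-monoʳ-≤ a (m≤m+n q (q + 0))))))))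
              (light 0 (arrange₃ y m q)
                (≤-trans (lower (y + q) m) (≤-trans (lower y (2 + m)) (bound y (4 + m) y<q
                  (≤-<-trans (≤-reflexive (arrange₅ y m q)) (+-monoˡ-< (2 * q) s<a))))))
              (λ eq → 1+n≢n (cong proj₂ eq))
              (λ eq → m≢1+m+n m (trans (sym (cong proj₂ eq)) (cong suc (+-comm 1 m))))
              (λ eq → 1+n≢n (cong proj₂ eq))
            where
            arrange₁ : ∀ y m q → y + q * (2 + m) ≡ q + (q + (y + q * m)) + 0
            arrange₁ = solve-∀
            arrange₂ : ∀ y m q → y + q + q * (1 + m) ≡ q + (q + (y + q * m)) + 0
            arrange₂ = solve-∀
            arrange₃ : ∀ y m q → y + q + q + q * m ≡ q + (q + (y + q * m)) + 0
            arrange₃ = solve-∀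
            arrange₄ : ∀ y m q → y + q * (3 + m) ≡ q + (q + (y + q * m)) + q
            arrange₄ = solve-∀
            arrange₅ : ∀ y m q → y + q * (4 + m) ≡ q + (q + (y + q * m)) + 2 * q
            arrange₅ = solve-∀

        H<q : H < q
        H<q = +-cancelʳ-≤ (r * q) (suc H) q (≤-trans (≤-reflexive H≡) a≤)

        rq<a : r * q < a
        rq<a = ≤-trans (+-monoˡ-≤ (r * q) (s≤s (z≤n {H}))) (≤-reflexive H≡)

        2q≤rq : 2 * q ≤ r * q
        2q≤rq = *-monoˡ-≤ q 2≤r

      -- With `b` added, (P, r + 1) weighs c + e a + (r + 1) c, so the hypothesis says that (H, r +
      -- 2) is at least as heavy. Here T + 1 = a + 2 q, and r ≥ 2 gives 2 q < a, hence T < 2 a.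
      frobenius-f₁ : e * a ≤ suc H * b →
        IsFrobeniusNumber 2 generators (+ H ℤ.* + b ℤ.+ + (2 + r) ℤ.* + c ℤ.- + a)
      frobenius-f₁ ea≤ = isFrobeniusNumber H (2 + r) (≤-trans (s≤s z≤n) (m≤n+m (2 + r) H)) (eY≤c H<q)
        (lights ≤-refl (weight-≤ P (suc r) H (2 + r) (begin
          suc P * b + suc r * c         ≡⟨ cong (λ t → t * b + suc r * c) P≡ ⟩
          q * b + suc r * c             ≡⟨ cong (λ t → t + suc r * c) (sym c+ea≡qb) ⟩
          c + e * a + suc r * c         ≤⟨ +-monoˡ-≤ (suc r * c) (+-monoʳ-≤ c ea≤) ⟩
          c + suc H * b + suc r * c     ≡⟨ arrange₁ c (suc H * b) r ⟩
          suc H * b + (2 + r) * c       ∎)))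
        (_ , refl , classes₁₀₁₁ H<q (≤-reflexive T≡) (begin
          suc H + q * (2 + r)           ≡⟨ T≡ ⟩
          q * 2 + 1 * a                 ≡⟨ cong (λ t → t + 1 * a) (*-comm q 2) ⟩
          2 * q + 1 * a                 ≤⟨ +-monoˡ-≤ (1 * a) (≤-trans 2q≤rq (<⇒≤ rq<a)) ⟩
          a + 1 * a                     ≤⟨ m≤n+m (2 * a) (q * 0) ⟩
          q * 0 + 2 * a                 ∎))
        where
        arrange₁ : ∀ c u r → c + u + suc r * c ≡ u + (2 + r) * c
        arrange₁ = solve-∀
        arrange₂ : ∀ q H r → suc H + q * (2 + r) ≡ q * 2 + 1 * (suc H + r * q)
        arrange₂ = solve-∀
        T≡ : suc H + q * (2 + r) ≡ q * 2 + 1 * a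
        T≡ = trans (arrange₂ q H r) (cong (λ t → q * 2 + 1 * t) H≡)

      frobenius-f₂ : suc H * b ≤ e * a →
        IsFrobeniusNumber 2 generators (+ P ℤ.* + b ℤ.+ + (1 + r) ℤ.* + c ℤ.- + a)
      frobenius-f₂ ≤ea = isFrobeniusNumber P (1 + r) (≤-trans (s≤s z≤n) (m≤n+m (1 + r) P)) (eY≤c P<q)
        (lights (weight-≤ H (2 + r) P (suc r) (begin
          suc H * b + (2 + r) * c       ≡⟨ arrange₁ c (suc H * b) r ⟩
          c + suc H * b + suc r * c     ≤⟨ +-monoˡ-≤ (suc r * c) (+-monoʳ-≤ c ≤ea) ⟩
          c + e * a + suc r * c         ≡⟨ cong (λ t → t + suc r * c) c+ea≡qb ⟩
          q * b + suc r * c             ≡⟨ cong (λ t → t * b + suc r * c) (sym P≡) ⟩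
          suc P * b + suc r * c         ∎)) ≤-refl)
        (_ , refl , classes₁₀₁₁ P<q (begin
          suc P + q * suc r             ≡⟨ T≡ ⟩
          q * 2 + r * q                 ≤⟨ +-monoʳ-≤ (q * 2) (≤-trans (<⇒≤ rq<a) (m≤m+n a 0)) ⟩
          q * 2 + 1 * a                 ∎) (begin
          suc P + q * suc r             ≡⟨ T≡ ⟩
          q * 2 + r * q                 ≡⟨ cong (λ t → t + r * q) (*-comm q 2) ⟩
          2 * q + r * q                 ≤⟨ +-mono-≤ (≤-trans 2q≤rq (<⇒≤ rq<a)) (≤-trans (<⇒≤ rq<a) (m≤m+n a 0)) ⟩
          2 * a                         ≤⟨ m≤n+m (2 * a) (q * 0) ⟩
          q * 0 + 2 * a                 ∎))
        where
        P<q = ≤-reflexive P≡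
        arrange₁ : ∀ c u r → u + (2 + r) * c ≡ c + u + suc r * c
        arrange₁ = solve-∀
        arrange₂ : ∀ q r → q + q * suc r ≡ q * 2 + r * q
        arrange₂ = solve-∀
        T≡ : suc P + q * suc r ≡ q * 2 + r * q
        T≡ = trans (cong (λ t → t + q * suc r) P≡) (arrange₂ q r)

    module _ {Y : ℕ} (Y≡ : suc Y + 3 * q ≡ 2 * a) (a≤2q : a ≤ 2 * q)
             (ea≤ : e * a ≤ suc Y * b) (3ea+qb≤ : 3 * (e * a) + q * b ≤ a * b) where

      private
        Y<q : Y < q
        Y<q = +-cancelʳ-≤ (3 * q) (suc Y) q (begin
          suc Y + 3 * q    ≡⟨ Y≡ ⟩
          2 * a            ≤⟨ *-monoʳ-≤ 2 a≤2q ⟩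
          2 * (2 * q)      ≡⟨ arrange q ⟩
          q + 3 * q        ∎)
          where
          arrange : ∀ q → 2 * (2 * q) ≡ q + 3 * q
          arrange = solve-∀

        -- Now a ≤ 2 q and 2 a = (Y + 1) + 3 q: greedy pairs below 2 a have n ≤ 2, or n = 3 and y ≤
        -- Y.
        bound : ∀ y n → y < q → y + q * n < 2 * a → y * b + n * c ≤ Y * b + 3 * c
        bound y n y<q t< with ≤-<-connex n 2
        ... | inj₁ n≤2 = weight-≤ y n Y 3 (begin
          suc y * b + n * c          ≤⟨ +-mono-≤ (*-monoˡ-≤ b y<q) (*-monoˡ-≤ c n≤2) ⟩
          q * b + 2 * c              ≡⟨ cong (λ t → t + 2 * c) (sym c+ea≡qb) ⟩
          c + e * a + 2 * c          ≤⟨ +-monoˡ-≤ (2 * c) (+-monoʳ-≤ c ea≤) ⟩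
          c + suc Y * b + 2 * c      ≡⟨ arrange c (suc Y * b) ⟩
          suc Y * b + 3 * c          ∎)
          where
          arrange : ∀ c u → c + u + 2 * c ≡ u + 3 * c
          arrange = solve-∀
        ... | inj₂ 3≤n with m≤n⇒∃[o]m+o≡n 3≤n
        ...   | zero , refl = +-monoˡ-≤ (3 * c) (*-monoˡ-≤ b (s≤s⁻¹ (+-cancelʳ-< (3 * q) y (suc Y) (begin-strict
          y + 3 * q        ≡⟨ cong (λ t → y + t) (*-comm 3 q) ⟩
          y + q * 3        <⟨ t< ⟩
          2 * a            ≡⟨ sym Y≡ ⟩
          suc Y + 3 * q    ∎))))
        ...   | suc o , refl = ⊥-elim (<⇒≱ t< (begin
          2 * a                          ≤⟨ *-monoʳ-≤ 2 a≤2q ⟩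
          2 * (2 * q)                    ≤⟨ slack (y + q * o) (arrange y q o) ⟩
          y + q * suc (2 + suc o)        ∎))
          where
          arrange : ∀ y q o → 2 * (2 * q) + (y + q * o) ≡ y + q * suc (2 + suc o)
          arrange = solve-∀

        -- For pairs with z = 0 the detour through `lower` may leave the range of `bound`. Instead
        -- (Y + 1) b + 3 c = 2 a b - 3 e a is compared with (a + q) b directly.
        bound₀ : ∀ t → t < a + q → t * b + 0 * c ≤ Y * b + 3 * c
        bound₀ t t< = weight-≤ t 0 Y 3 (+-cancelʳ-≤ (3 * (e * a)) _ _ (begin
          suc t * b + 0 * c + 3 * (e * a)      ≤⟨ +-monoˡ-≤ (3 * (e * a)) (+-monoˡ-≤ 0 (*-monoˡ-≤ b t<)) ⟩
          (a + q) * b + 0 * c + 3 * (e * a)    ≡⟨ arrange₁ a q b (3 * (e * a)) ⟩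
          3 * (e * a) + q * b + a * b          ≤⟨ +-monoˡ-≤ (a * b) 3ea+qb≤ ⟩
          a * b + a * b                        ≡⟨ arrange₂ a b ⟩
          2 * a * b                            ≡⟨ cong (λ u → u * b) (sym Y≡) ⟩
          (suc Y + 3 * q) * b                  ≡⟨ arrange₃ (suc Y) q b ⟩
          suc Y * b + 3 * (q * b)              ≡⟨ cong (λ u → suc Y * b + 3 * u) (sym c+ea≡qb) ⟩
          suc Y * b + 3 * (c + e * a)          ≡⟨ arrange₄ (suc Y * b) c (e * a) ⟩
          suc Y * b + 3 * c + 3 * (e * a)      ∎))
          where
          arrange₁ : ∀ a q b u → (a + q) * b + 0 + u ≡ u + q * b + a * b
          arrange₁ = solve-∀
          arrange₂ : ∀ a b → a * b + a * b ≡ 2 * a * b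
          arrange₂ = solve-∀
          arrange₃ : ∀ p q b → (p + 3 * q) * b ≡ p * b + 3 * (q * b)
          arrange₃ = solve-∀
          arrange₄ : ∀ u c v → u + 3 * (c + v) ≡ u + 3 * c + 3 * v
          arrange₄ = solve-∀

        below-2a : ∀ {s} → s < a → s + a < 2 * a
        below-2a s<a = ≤-trans (+-monoˡ-< a s<a) (+-monoʳ-≤ a (m≤m+n a 0))

        lights : ∀ s → s < a → Lights 3 Y 3 s
        lights s s<a with <-≤-connex s q
        ... | inj₁ s<q = case (quotRem q 0<q (s + a))
          where
          case : (∃₂ λ y z → y < q × y + q * z ≡ s + a) → Lights 3 Y 3 s
          case (y , zero , y<q , t≡) = ⊥-elim (<⇒≱ y<q (begin
            q            ≤⟨ q≤a ⟩
            a            ≤⟨ m≤n+m a s ⟩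
            s + a        ≡⟨ sym t≡ ⟩
            y + q * 0    ≡⟨ trans (cong (λ u → y + u) (*-zeroʳ q)) (+-identityʳ y) ⟩
            y            ∎))
          case (y , suc z , y<q , t≡) = three₀₁
            (light 1 (arrange s a q) (bound₀ (s + a) (≤-trans (+-monoˡ-< a s<q) (≤-reflexive (+-comm q a)))))
            (light 1 (trans t≡ (cong (λ u → s + u) (sym (*-identityˡ a))))
              (bound y (suc z) y<q (≤-<-trans (≤-reflexive t≡) (below-2a s<a))))
            where
            arrange : ∀ s a q → s + a + q * 0 ≡ s + 1 * a
            arrange = solve-∀
        ... | inj₂ q≤s with m≤n⇒∃[o]m+o≡n q≤s
        ...   | o , refl = case (quotRem q 0<q (q + o + a))
          where
          arrange₁ : ∀ o q → o + q * 1 ≡ q + o + 0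
          arrange₁ = solve-∀
          arrange₂ : ∀ o q → q + o + q * 0 ≡ q + o + 0
          arrange₂ = solve-∀
          o<q : o < q
          o<q = +-cancelˡ-< q o q (<-≤-trans s<a (≤-trans a≤2q (+-monoʳ-≤ q (≤-reflexive (+-identityʳ q)))))
          case : (∃₂ λ y z → y < q × y + q * z ≡ q + o + a) → Lights 3 Y 3 (q + o)
          case (y , z , y<q , t≡) = three
            (light 0 (arrange₁ o q)
              (bound o 1 o<q (≤-<-trans (≤-reflexive (trans (arrange₁ o q) (+-identityʳ (q + o))))
                (<-≤-trans s<a (m≤m+n a (a + 0))))))
            (light 0 (arrange₂ o q) (bound₀ (q + o) (<-≤-trans s<a (m≤m+n a q))))
            (light 1 (trans t≡ (cong (λ u → q + o + u) (sym (*-identityˡ a))))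
              (bound y z y<q (≤-<-trans (≤-reflexive t≡) (below-2a s<a))))
            (λ ())
            (distinct (trans (arrange₁ o q) (+-identityʳ (q + o))) t≡)
            (distinct (trans (arrange₂ o q) (+-identityʳ (q + o))) t≡)

      frobenius-e : IsFrobeniusNumber 2 generators (+ Y ℤ.* + b ℤ.+ + 3 ℤ.* + c ℤ.- + a)
      frobenius-e = isFrobeniusNumber Y 3 (≤-trans (s≤s z≤n) (m≤n+m 3 Y)) (eY≤c Y<q) lights
        (_ , refl , classes₁₀₁₁ Y<q (begin
          suc Y + q * 3      ≡⟨ T≡ ⟩
          2 * a              ≡⟨ arrange₁ a ⟩
          a + 1 * a          ≤⟨ +-monoˡ-≤ (1 * a) (≤-trans a≤2q (≤-reflexive (*-comm 2 q))) ⟩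
          q * 2 + 1 * a      ∎) (begin
          suc Y + q * 3      ≡⟨ T≡ ⟩
          2 * a              ≤⟨ m≤n+m (2 * a) (q * 0) ⟩
          q * 0 + 2 * a      ∎))
        where
        arrange₁ : ∀ a → 2 * a ≡ a + 1 * a
        arrange₁ = solve-∀
        T≡ : suc Y + q * 3 ≡ 2 * a
        T≡ = trans (cong (λ t → suc Y + t) (*-comm q 3)) Y≡

  -- For i = 4 the quantity F_{i-4} playing `suc Y` is 0, and the comparison e a ≤ (Y + 1) b fails.
  -- The other candidate (q - 1, 2) = (1, 2) wins, attained at s = 2.
  frobenius-3-8-13 : Coprime 3 8 → IsFrobeniusNumber 2 (3 ∷ 8 ∷ 13 ∷ []) (+ 31)
  frobenius-3-8-13 coprime = isFrobeniusNumber 1 2 (s≤s z≤n) (s≤s z≤n) lights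
    (_ , refl , classes₁₀₁₁ ≤-refl (≤ᵇ⇒≤ _ _ tt) (≤ᵇ⇒≤ _ _ tt))
    where
    open Criterion 3 8 13 2 1 refl coprime (s≤s z≤n) (s≤s z≤n) (≤ᵇ⇒≤ _ _ tt) (≤ᵇ⇒≤ _ _ tt)
    lights : ∀ s → s < 3 → Lights 3 1 2 s
    lights 0 _ = three {p₁ = 0 , 0} {3 , 0} {1 , 1} (light 0 refl z≤n) (light 1 refl (≤ᵇ⇒≤ _ _ tt)) (light 1 refl (≤ᵇ⇒≤ _ _ tt)) (λ ()) (λ ()) (λ ())
    lights 1 _ = three {p₁ = 1 , 0} {0 , 2} {2 , 1} (light 0 refl (≤ᵇ⇒≤ _ _ tt)) (light 1 refl (≤ᵇ⇒≤ _ _ tt)) (light 1 refl (≤ᵇ⇒≤ _ _ tt)) (λ ()) (λ ()) (λ ())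
    lights 2 _ = three {p₁ = 2 , 0} {0 , 1} {1 , 2} (light 0 refl (≤ᵇ⇒≤ _ _ tt)) (light 0 refl (≤ᵇ⇒≤ _ _ tt)) (light 1 refl (≤ᵇ⇒≤ _ _ tt)) (λ ()) (λ ()) (λ ())
    lights (suc (suc (suc s))) (s≤s (s≤s (s≤s ())))

  -- Fibonacci numbers

  F-step : ∀ n → F n ≤ F (suc n)
  F-step zero    = z≤n
  F-step (suc n) = m≤m+n (F (suc n)) (F n)

  F-mono : ∀ {m n} → m ≤ n → F m ≤ F n
  F-mono {m} m≤n with o , refl ← m≤n⇒∃[o]m+o≡n m≤n = go o
    where
    go : ∀ o → F m ≤ F (m + o)
    go zero    = ≤-reflexive (cong F (sym (+-identityʳ m)))
    go (suc o) = ≤-trans (go o) (≤-trans (F-step (m + o)) (≤-reflexive (cong F (sym (+-suc m o)))))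

  F-double : ∀ n → 2 * F n ≤ F (2 + n)
  F-double n = ≤-trans (≤-reflexive (cong (λ t → F n + t) (+-identityʳ (F n)))) (+-monoˡ-≤ (F n) (F-step n))

  -- Both sides obey the Fibonacci recurrence in `j`. With k = 2 + j this is the relation c + e a =
  -- q b.
  F-addition : ∀ i j → F (2 + j + i) + F j * F i ≡ F (2 + j) * F (2 + i)
  F-addition i zero          = refl
  F-addition i (suc zero)    = arrange (F (suc i)) (F i)
    where
    arrange : ∀ f h → f + h + f + (h + 0) ≡ f + h + (f + h + 0)
    arrange = solve-∀
  F-addition i (suc (suc j)) = begin-equality
    x + y + (F (suc j) + F j) * F i                ≡⟨ arrange₁ x y (F (suc j)) (F j) (F i) ⟩
    x + F (suc j) * F i + (y + F j * F i)          ≡⟨ cong₂ _+_ (F-addition i (suc j)) (F-addition i j) ⟩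
    F (3 + j) * F (2 + i) + F (2 + j) * F (2 + i)  ≡⟨ sym (*-distribʳ-+ (F (2 + i)) (F (3 + j)) (F (2 + j))) ⟩
    (F (3 + j) + F (2 + j)) * F (2 + i)            ∎
    where
    x = F (3 + j + i)
    y = F (2 + j + i)
    arrange₁ : ∀ x y p q r → x + y + (p + q) * r ≡ x + p * r + (y + q * r)
    arrange₁ = solve-∀

  F-consecutive-coprime : ∀ n → Coprime (F n) (F (suc n))
  F-consecutive-coprime zero    = Coprimality.sym (Coprimality.1-coprimeTo 0)
  F-consecutive-coprime (suc n) = Coprimality.sym (coprime-+ (F-consecutive-coprime n))

  F-coprime : ∀ n → Coprime (F n) (F (2 + n))
  F-coprime n = Coprimality.sym (subst (λ m → Coprime m (F n)) (+-comm (F n) (F (suc n)))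
    (coprime-+ (Coprimality.sym (F-consecutive-coprime n))))

  -- The form f f - f h - h h changes sign under (f, h) to (f + h, f). Only the sign in Cassini's
  -- identity is needed, so inequalities suffice.
  cassini-step : ∀ f h → f * h + h * h ≤ f * f → (f + h) * (f + h) ≤ (f + h) * f + f * f
  cassini-step f h le = begin
    (f + h) * (f + h)                  ≡⟨ arrange₁ f h ⟩
    f * f + f * h + (f * h + h * h)    ≤⟨ +-monoʳ-≤ (f * f + f * h) le ⟩
    f * f + f * h + f * f              ≡⟨ arrange₂ f h ⟩
    (f + h) * f + f * f                ∎
    where
    arrange₁ : ∀ f h → (f + h) * (f + h) ≡ f * f + f * h + (f * h + h * h)
    arrange₁ = solve-∀
    arrange₂ : ∀ f h → f * f + f * h + f * f ≡ (f + h) * f + f * f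
    arrange₂ = solve-∀

  cassini-step′ : ∀ f h → f * f ≤ f * h + h * h → (f + h) * f + f * f ≤ (f + h) * (f + h)
  cassini-step′ f h le = begin
    (f + h) * f + f * f                ≡⟨ arrange₁ f h ⟩
    f * f + f * h + f * f              ≤⟨ +-monoʳ-≤ (f * f + f * h) le ⟩
    f * f + f * h + (f * h + h * h)    ≡⟨ arrange₂ f h ⟩
    (f + h) * (f + h)                  ∎
    where
    arrange₁ : ∀ f h → (f + h) * f + f * f ≡ f * f + f * h + f * f
    arrange₁ = solve-∀
    arrange₂ : ∀ f h → f * f + f * h + (f * h + h * h) ≡ (f + h) * (f + h)
    arrange₂ = solve-∀

  cassini-even : ∀ n → 2 ∣ n → F (suc n) * F n + F n * F n ≤ F (suc n) * F (suc n)
  cassini-even 0             _    = z≤n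
  cassini-even 1             2∣1  = ⊥-elim (>⇒∤ ≤-refl 2∣1)
  cassini-even (suc (suc n)) 2∣n  =
    cassini-step′ (F (2 + n)) (F (1 + n)) (cassini-step (F (1 + n)) (F n) (cassini-even n (∣m+n∣m⇒∣n 2∣n ∣-refl)))

  cassini-odd : ∀ n → 2 ∤ n → F (suc n) * F (suc n) ≤ F (suc n) * F n + F n * F n
  cassini-odd 0             2∤0 = ⊥-elim (2∤0 (2 ∣0))
  cassini-odd 1             _   = s≤s z≤n
  cassini-odd (suc (suc n)) 2∤n =
    cassini-step (F (2 + n)) (F (1 + n)) (cassini-step′ (F (1 + n)) (F n) (cassini-odd n (λ 2∣n → 2∤n (∣m∣n⇒∣m+n ∣-refl 2∣n))))

  F-triple : ∀ n → 3 * F n ≤ F (3 + n)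
  F-triple n = begin
    3 * F n                  ≡⟨ *-distribʳ-+ (F n) 2 1 ⟩
    2 * F n + 1 * F n        ≤⟨ +-mono-≤ (F-double n) (≤-trans (≤-reflexive (+-identityʳ (F n))) (F-step n)) ⟩
    F (2 + n) + F (1 + n)    ∎

  e*a≤c : ∀ {a b c q e} → c + e * a ≡ q * b → e ≤ q → 2 * a ≤ b → e * a ≤ c
  e*a≤c {a} {b} {c} {q} {e} c+ea≡qb e≤q 2a≤b = +-cancelʳ-≤ (e * a) (e * a) c (begin
    e * a + e * a    ≡⟨ arrange e a ⟩
    e * (2 * a)      ≤⟨ *-mono-≤ e≤q 2a≤b ⟩
    q * b            ≡⟨ sym c+ea≡qb ⟩
    c + e * a        ∎)
    where
    arrange : ∀ e a → e * a + e * a ≡ e * (2 * a)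
    arrange = solve-∀

open OverNaturals

open import Data.Empty using (⊥-elim)
open import Data.Integer.Base as ℤ using (ℤ; +_; _+_; _-_; _*_; _≥_; _<_)
import Data.Integer.Properties as ℤ
open import Data.Nat.Base as ℕ using (ℕ; zero; suc; pred; z≤n; s≤s; _∸_)
open import Data.Nat.DivMod using (_/_; _%_; m≡m%n+[m/n]*n; m%n<n; /-monoˡ-≤; m*n/n≡m; m/n*n≤m)
open import Data.Nat.Divisibility using (_∣_; _∤_; ∣m+n∣m⇒∣n; ∣m∣n⇒∣m+n; ∣-refl)
import Data.Nat.Properties as ℕ
open import Data.Nat.Tactic.RingSolver using (solve-∀)
open import Data.Product.Base using (_×_; _,_)
open import Data.Vec.Base using ([]; _∷_)
open import Function.Bundles using (_⇔_; mk⇔)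
open import Relation.Binary.PropositionalEquality

-- From natural numbers to the claimed integer values

+-∸-cancelʳ : ∀ m n k → m ℕ.+ n ≡ k → + m ≡ + k - + n
+-∸-cancelʳ m n k refl = sym (trans (ℤ.m-n≡m⊖n (m ℕ.+ n) n)
  (trans (ℤ.⊖-≥ (ℕ.m≤n+m n m)) (cong +_ (ℕ.m+n∸n≡m m n))))

+pred : ∀ {m n} → suc m ≡ n → + m ≡ + n - + 1
+pred {m} {n} eq = +-∸-cancelʳ m 1 n (trans (ℕ.+-comm m 1) eq)

no-third : ∀ i j → i + + 0 * j ≡ i
no-third i j = trans (cong (λ t → i + t) (ℤ.*-zeroˡ j)) (ℤ.+-identityʳ i)

suc-pred-F : ∀ n → suc (pred (F (suc n))) ≡ F (suc n)
suc-pred-F n = ℕ.suc-pred (F (suc n)) {{ℕ.>-nonZero (F-positive n)}}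

case-a : ∀ i j → 3 ℕ.≤ i → i ℕ.+ 3 ℕ.≤ 2 ℕ.+ j →
  IsFrobeniusNumber 2 (F i ∷ F (2 ℕ.+ i) ∷ F (2 ℕ.+ j ℕ.+ i) ∷ [])
    ((+ 3 * + F i - + 1) * + F (2 ℕ.+ i) - + F i)
case-a i@(suc i′) j 3≤i i+3≤k = subst (IsFrobeniusNumber 2 _) g≡
  (frobenius-a {e = F j} Y≡ 3a≤q (F-double i) (F-double j) (F-addition i j) (F-coprime i)
    0<a (F-positive (suc j)) (F-mono (ℕ.m≤n+m i 2)) (F-mono (ℕ.m≤n+m i (2 ℕ.+ j))))
  where
  0<a = F-positive i′
  Y = pred (3 ℕ.* F i)
  Y≡ : suc Y ≡ 3 ℕ.* F i
  Y≡ = ℕ.suc-pred (3 ℕ.* F i) {{ℕ.>-nonZero (ℕ.≤-trans 0<a (ℕ.m≤m+n (F i) (F i ℕ.+ (F i ℕ.+ 0))))}}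
  3a≤q : 3 ℕ.* F i ℕ.≤ F (2 ℕ.+ j)
  3a≤q = ℕ.≤-trans (F-triple i) (F-mono (ℕ.≤-trans (ℕ.≤-reflexive (ℕ.+-comm 3 i)) i+3≤k))
  g≡ : + Y * + F (2 ℕ.+ i) + + 0 * + F (2 ℕ.+ j ℕ.+ i) - + F i ≡ (+ 3 * + F i - + 1) * + F (2 ℕ.+ i) - + F i
  g≡ = cong (λ t → t - + F i) (trans (no-third _ (+ F (2 ℕ.+ j ℕ.+ i)))
    (cong (λ t → t * + F (2 ℕ.+ i)) (trans (+pred Y≡) (cong (λ t → t - + 1) (ℤ.pos-* 3 (F i))))))

-- With i = 3 + n, `F i` unfolds to f + h for f = F_{i-1} and h = F_{i-2}. `F-addition` at j = i, 2
-- + n and 1 + n gives k = i + 2, i + 1 and i.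
module _ (n : ℕ) where

  private
    i a b : ℕ
    i = 3 ℕ.+ n
    a = F i
    b = F (2 ℕ.+ i)

  open Consecutive (F (2 ℕ.+ n)) (F (1 ℕ.+ n)) (F-positive (1 ℕ.+ n)) (F-positive n) (F-step (1 ℕ.+ n))
    using (frobenius-b-even; frobenius-b-odd; frobenius-c; frobenius-d)

  case-b-even : ∀ m → m ≡ 2 ℕ.+ i ℕ.+ i → 2 ∣ i →
    IsFrobeniusNumber 2 (a ∷ b ∷ F m ∷ []) ((+ b - + 1) * + b - + a)
  case-b-even _ refl 2∣i = subst (IsFrobeniusNumber 2 _) g≡
    (frobenius-b-even (F-addition i i) (F-coprime i) (F-mono (ℕ.m≤n+m i (2 ℕ.+ i))) Y≡
      (cassini-even (1 ℕ.+ n) (∣m+n∣m⇒∣n 2∣i ∣-refl)))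
    where
    Y≡ = suc-pred-F (4 ℕ.+ n)
    g≡ : + (pred b) * + b + + 0 * + F (2 ℕ.+ i ℕ.+ i) - + a ≡ (+ b - + 1) * + b - + a
    g≡ = cong (λ t → t - + a) (trans (no-third _ (+ F (2 ℕ.+ i ℕ.+ i))) (cong (λ t → t * + b) (+pred Y≡)))

  case-b-odd : ∀ m → m ≡ 2 ℕ.+ i ℕ.+ i → 2 ∤ i →
    IsFrobeniusNumber 2 (a ∷ b ∷ F m ∷ []) ((+ F (1 ℕ.+ n) - + 1) * + b + + F m - + a)
  case-b-odd m refl 2∤i = subst (IsFrobeniusNumber 2 _) g≡
    (frobenius-b-odd (F-addition i i) (F-coprime i) (F-mono (ℕ.m≤n+m i (2 ℕ.+ i))) Y≡
      (cassini-odd (1 ℕ.+ n) (λ 2∣ → 2∤i (∣m∣n⇒∣m+n ∣-refl 2∣))))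
    where
    Y≡ = suc-pred-F n
    g≡ : + (pred (F (1 ℕ.+ n))) * + b + + 1 * + F m - + a ≡ (+ F (1 ℕ.+ n) - + 1) * + b + + F m - + a
    g≡ = cong₂ (λ s t → s * + b + t - + a) (+pred Y≡) (ℤ.*-identityˡ (+ F m))

  case-c : ∀ m → m ≡ 1 ℕ.+ i ℕ.+ i →
    IsFrobeniusNumber 2 (a ∷ b ∷ F m ∷ []) ((+ a - + 1) * + b + + F m - + a)
  case-c m refl = subst (IsFrobeniusNumber 2 _) g≡
    (frobenius-c (F-addition i (2 ℕ.+ n)) (F-coprime i) (F-mono (ℕ.m≤n+m i (1 ℕ.+ i))) Y≡)
    where
    Y≡ = suc-pred-F (2 ℕ.+ n)
    g≡ : + (pred a) * + b + + 1 * + F m - + a ≡ (+ a - + 1) * + b + + F m - + a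
    g≡ = cong₂ (λ s t → s * + b + t - + a) (+pred Y≡) (ℤ.*-identityˡ (+ F m))

  case-d : ∀ m → m ≡ i ℕ.+ i →
    IsFrobeniusNumber 2 (a ∷ b ∷ F m ∷ []) ((+ 2 * + a - + 1) * + b - + a)
  case-d m refl = subst (IsFrobeniusNumber 2 _) g≡
    (frobenius-d (F-addition i (1 ℕ.+ n)) (F-coprime i) (F-mono (ℕ.m≤n+m i i)) Y≡)
    where
    Y≡ : suc (pred (2 ℕ.* a)) ≡ 2 ℕ.* a
    Y≡ = ℕ.suc-pred (2 ℕ.* a) {{ℕ.>-nonZero (ℕ.≤-trans (F-positive (2 ℕ.+ n)) (ℕ.m≤m+n a (a ℕ.+ 0)))}}
    g≡ : + (pred (2 ℕ.* a)) * + b + + 0 * + F m - + a ≡ (+ 2 * + a - + 1) * + b - + a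
    g≡ = cong (λ t → t - + a) (trans (no-third _ (+ F m))
      (cong (λ t → t * + b) (trans (+pred Y≡) (cong (λ t → t - + 1) (ℤ.pos-* 2 a)))))

-- The coefficient F_{i-4} is 2 F_i - 3 F_{i-1}, the remainder of 2 a after three steps of q. In
-- terms of u = F_{i-4} and v = F_{i-3}, the inequalities become quadratic and follow from v ≤ 2 u.
case-e : ∀ n m → m ≡ 4 ℕ.+ n ℕ.+ (5 ℕ.+ n) → let i = 5 ℕ.+ n in
  IsFrobeniusNumber 2 (F i ∷ F (2 ℕ.+ i) ∷ F m ∷ [])
    ((+ F (1 ℕ.+ n) - + 1) * + F (2 ℕ.+ i) + + 3 * + F m - + F i)
case-e n m refl = subst (IsFrobeniusNumber 2 _) g≡
  (SmallStep.frobenius-e {e = v} (F-addition i (2 ℕ.+ n)) (F-coprime i) (F-positive (3 ℕ.+ n)) (F-step (4 ℕ.+ n)) (F-mono (ℕ.m≤n+m i 2))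
    (F-mono (ℕ.m≤n+m i (4 ℕ.+ n)))
    (e*a≤c {e = v} (F-addition i (2 ℕ.+ n)) (F-mono (ℕ.m≤n+m (2 ℕ.+ n) 2)) (F-double i))
    {Y = pred u} Y≡ (ℕ.≤-trans (ℕ.+-monoʳ-≤ q (F-step (3 ℕ.+ n))) (ℕ.≤-reflexive (cong (λ t → q ℕ.+ t) (sym (ℕ.+-identityʳ q)))))
    ea≤ 3ea+qb≤)
  where
  open ℕ.≤-Reasoning
  i = 5 ℕ.+ n
  q = F (4 ℕ.+ n)
  u = F (1 ℕ.+ n)
  v = F (2 ℕ.+ n)
  a≡ : F i ≡ 2 ℕ.* u ℕ.+ 3 ℕ.* v
  a≡ = arrange u v
    where
    arrange : ∀ u v → v ℕ.+ u ℕ.+ v ℕ.+ (v ℕ.+ u) ≡ 2 ℕ.* u ℕ.+ 3 ℕ.* v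
    arrange = solve-∀
  b≡ : F (2 ℕ.+ i) ≡ 5 ℕ.* u ℕ.+ 8 ℕ.* v
  b≡ = arrange u v
    where
    arrange : ∀ u v → v ℕ.+ u ℕ.+ v ℕ.+ (v ℕ.+ u) ℕ.+ (v ℕ.+ u ℕ.+ v) ℕ.+ (v ℕ.+ u ℕ.+ v ℕ.+ (v ℕ.+ u))
              ≡ 5 ℕ.* u ℕ.+ 8 ℕ.* v
    arrange = solve-∀
  v≤2u : v ℕ.≤ 2 ℕ.* u
  v≤2u = ℕ.+-monoʳ-≤ u (ℕ.≤-trans (F-step n) (ℕ.≤-reflexive (sym (ℕ.+-identityʳ u))))
  ea≤ : v ℕ.* F i ℕ.≤ suc (pred u) ℕ.* F (2 ℕ.+ i)
  ea≤ = begin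
    v ℕ.* F i                                        ≡⟨ cong (λ t → v ℕ.* t) a≡ ⟩
    v ℕ.* (2 ℕ.* u ℕ.+ 3 ℕ.* v)                      ≡⟨ arrange₁ u v ⟩
    2 ℕ.* (u ℕ.* v) ℕ.+ 3 ℕ.* (v ℕ.* v)              ≤⟨ ℕ.+-monoʳ-≤ (2 ℕ.* (u ℕ.* v)) (ℕ.*-monoʳ-≤ 3 (ℕ.*-monoˡ-≤ v v≤2u)) ⟩
    2 ℕ.* (u ℕ.* v) ℕ.+ 3 ℕ.* (2 ℕ.* u ℕ.* v)        ≤⟨ slack (5 ℕ.* (u ℕ.* u)) (arrange₂ u v) ⟩
    u ℕ.* (5 ℕ.* u ℕ.+ 8 ℕ.* v)                      ≡⟨ cong₂ ℕ._*_ (sym (suc-pred-F n)) (sym b≡) ⟩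
    suc (pred u) ℕ.* F (2 ℕ.+ i)                     ∎
    where
    arrange₁ : ∀ u v → v ℕ.* (2 ℕ.* u ℕ.+ 3 ℕ.* v) ≡ 2 ℕ.* (u ℕ.* v) ℕ.+ 3 ℕ.* (v ℕ.* v)
    arrange₁ = solve-∀
    arrange₂ : ∀ u v → 2 ℕ.* (u ℕ.* v) ℕ.+ 3 ℕ.* (2 ℕ.* u ℕ.* v) ℕ.+ 5 ℕ.* (u ℕ.* u) ≡ u ℕ.* (5 ℕ.* u ℕ.+ 8 ℕ.* v)
    arrange₂ = solve-∀
  -- As a - q = v + u, this is 3 e a ≤ (a - q) b. Of the nine v v on the left eight are matched on
  -- the right, and `v≤2u` absorbs the ninth.
  3ea≤ : 3 ℕ.* (v ℕ.* F i) ℕ.≤ (v ℕ.+ u) ℕ.* F (2 ℕ.+ i)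
  3ea≤ = begin
    3 ℕ.* (v ℕ.* F i)                                ≡⟨ cong (λ t → 3 ℕ.* (v ℕ.* t)) a≡ ⟩
    3 ℕ.* (v ℕ.* (2 ℕ.* u ℕ.+ 3 ℕ.* v))              ≡⟨ arrange₁ u v ⟩
    6 ℕ.* (u ℕ.* v) ℕ.+ 8 ℕ.* (v ℕ.* v) ℕ.+ v ℕ.* v  ≤⟨ ℕ.+-monoʳ-≤ (6 ℕ.* (u ℕ.* v) ℕ.+ 8 ℕ.* (v ℕ.* v)) (ℕ.*-monoˡ-≤ v v≤2u) ⟩
    6 ℕ.* (u ℕ.* v) ℕ.+ 8 ℕ.* (v ℕ.* v) ℕ.+ 2 ℕ.* u ℕ.* v
                                                     ≤⟨ slack (5 ℕ.* (u ℕ.* u) ℕ.+ 5 ℕ.* (u ℕ.* v)) (arrange₂ u v) ⟩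
    (v ℕ.+ u) ℕ.* (5 ℕ.* u ℕ.+ 8 ℕ.* v)              ≡⟨ cong (λ t → (v ℕ.+ u) ℕ.* t) (sym b≡) ⟩
    (v ℕ.+ u) ℕ.* F (2 ℕ.+ i)                        ∎
    where
    arrange₁ : ∀ u v → 3 ℕ.* (v ℕ.* (2 ℕ.* u ℕ.+ 3 ℕ.* v)) ≡ 6 ℕ.* (u ℕ.* v) ℕ.+ 8 ℕ.* (v ℕ.* v) ℕ.+ v ℕ.* v
    arrange₁ = solve-∀
    arrange₂ : ∀ u v → 6 ℕ.* (u ℕ.* v) ℕ.+ 8 ℕ.* (v ℕ.* v) ℕ.+ 2 ℕ.* u ℕ.* v ℕ.+ (5 ℕ.* (u ℕ.* u) ℕ.+ 5 ℕ.* (u ℕ.* v))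
               ≡ (v ℕ.+ u) ℕ.* (5 ℕ.* u ℕ.+ 8 ℕ.* v)
    arrange₂ = solve-∀
  3ea+qb≤ : 3 ℕ.* (v ℕ.* F i) ℕ.+ q ℕ.* F (2 ℕ.+ i) ℕ.≤ F i ℕ.* F (2 ℕ.+ i)
  3ea+qb≤ = begin
    3 ℕ.* (v ℕ.* F i) ℕ.+ q ℕ.* F (2 ℕ.+ i)            ≤⟨ ℕ.+-monoˡ-≤ (q ℕ.* F (2 ℕ.+ i)) 3ea≤ ⟩
    (v ℕ.+ u) ℕ.* F (2 ℕ.+ i) ℕ.+ q ℕ.* F (2 ℕ.+ i)    ≡⟨ ℕ.+-comm ((v ℕ.+ u) ℕ.* F (2 ℕ.+ i)) _ ⟩
    q ℕ.* F (2 ℕ.+ i) ℕ.+ (v ℕ.+ u) ℕ.* F (2 ℕ.+ i)    ≡⟨ sym (ℕ.*-distribʳ-+ (F (2 ℕ.+ i)) q (v ℕ.+ u)) ⟩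
    F i ℕ.* F (2 ℕ.+ i)                                ∎
  Y≡ : suc (pred (F (1 ℕ.+ n))) ℕ.+ 3 ℕ.* F (4 ℕ.+ n) ≡ 2 ℕ.* F (5 ℕ.+ n)
  Y≡ = trans (cong (λ t → t ℕ.+ 3 ℕ.* F (4 ℕ.+ n)) (suc-pred-F n)) (arrange (F (1 ℕ.+ n)) (F (2 ℕ.+ n)))
    where
    arrange : ∀ u v → u ℕ.+ 3 ℕ.* (v ℕ.+ u ℕ.+ v) ≡ 2 ℕ.* (v ℕ.+ u ℕ.+ v ℕ.+ (v ℕ.+ u))
    arrange = solve-∀
  g≡ : + (pred (F (1 ℕ.+ n))) * + F (2 ℕ.+ i) + + 3 * + F m - + F i
       ≡ (+ F (1 ℕ.+ n) - + 1) * + F (2 ℕ.+ i) + + 3 * + F m - + F i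
  g≡ = cong (λ t → t * + F (2 ℕ.+ i) + + 3 * + F m - + F i) (+pred (suc-pred-F n))

module CaseF (i j r H : ℕ) (H≡ : suc H ℕ.+ r ℕ.* F (2 ℕ.+ j) ≡ F i)
             (H<q : H ℕ.< F (2 ℕ.+ j)) (2≤r : 2 ℕ.≤ r) where

  private
    a b c q e : ℕ
    a = F i
    b = F (2 ℕ.+ i)
    c = F (2 ℕ.+ j ℕ.+ i)
    q = F (2 ℕ.+ j)
    e = F j

    q≤a : q ℕ.≤ a
    q≤a = ℕ.≤-trans (ℕ.m≤n*m q r {{ℕ.>-nonZero (ℕ.≤-trans (s≤s z≤n) 2≤r)}})
      (ℕ.≤-trans (ℕ.m≤n+m (r ℕ.* q) (suc H)) (ℕ.≤-reflexive H≡))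

    a≤ : a ℕ.≤ suc r ℕ.* q
    a≤ = ℕ.≤-trans (ℕ.≤-reflexive (sym H≡)) (ℕ.+-monoˡ-≤ (r ℕ.* q) H<q)

    P≡ = suc-pred-F (suc j)

    open SmallStep {a} {b} {c} {q} {e} (F-addition i j) (F-coprime i) (F-positive (suc j)) q≤a (F-mono (ℕ.m≤n+m i 2))
      (F-mono (ℕ.m≤n+m i (2 ℕ.+ j))) (e*a≤c {e = e} (F-addition i j) (F-mono (ℕ.m≤n+m j 2)) (F-double i))

    sH≡ : + suc H ≡ + a - + r * + q
    sH≡ = trans (+-∸-cancelʳ (suc H) (r ℕ.* q) a H≡) (cong (λ t → + a - t) (ℤ.pos-* r q))

    +H≡ : + H ≡ + a - + r * + q - + 1
    +H≡ = trans (+pred refl) (cong (λ t → t - + 1) sH≡)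

    condition≡ : (+ a - + r * + q) * + b ≡ + (suc H ℕ.* b)
    condition≡ = trans (cong (λ t → t * + b) (sym sH≡)) (sym (ℤ.pos-* (suc H) b))

  case-f₁ : (+ a - + r * + q) * + b ≥ + e * + a →
    IsFrobeniusNumber 2 (a ∷ b ∷ c ∷ []) ((+ a - + r * + q - + 1) * + b + (+ r + + 2) * + c - + a)
  case-f₁ ge = subst (IsFrobeniusNumber 2 _)
    (cong₂ (λ s t → s * + b + + t * + c - + a) +H≡ (ℕ.+-comm 2 r))
    (frobenius-f₁ H≡ P≡ a≤ 2≤r (ℤ.drop‿+≤+ (subst₂ ℤ._≤_ (sym (ℤ.pos-* e a)) condition≡ ge)))

  case-f₂ : (+ a - + r * + q) * + b < + e * + a →
    IsFrobeniusNumber 2 (a ∷ b ∷ c ∷ []) ((+ q - + 1) * + b + (+ r + + 1) * + c - + a)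
  case-f₂ lt = subst (IsFrobeniusNumber 2 _)
    (cong₂ (λ s t → s * + b + + t * + c - + a) (+pred P≡) (ℕ.+-comm 1 r))
    (frobenius-f₂ H≡ P≡ a≤ 2≤r (ℕ.<⇒≤ (ℤ.drop‿+<+ (subst₂ _<_ condition≡ (sym (ℤ.pos-* e a)) lt))))

-- A quotient of at least 2 means 2 F_k < F_i, and 2 F_k lies between F_{k+1} and F_{k+2}, strictly
-- below the latter.
two≤ratio⇔ : ∀ i k (3≤k : 3 ℕ.≤ k) →
  2 ℕ.≤ _/_ (F i ∸ 1) (F k) {{F-nonZero 3≤k}} ⇔ k ℕ.+ 2 ℕ.≤ i
two≤ratio⇔ _ 1 (s≤s ())
two≤ratio⇔ _ 2 (s≤s (s≤s ()))
two≤ratio⇔ i (suc (suc (suc j))) 3≤k = mk⇔ to from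
  where
  open ℕ.≤-Reasoning
  k = 3 ℕ.+ j
  instance q≢0 = F-nonZero {k = k} 3≤k

  0<q = F-positive (2 ℕ.+ j)

  ≤∸1⇒< : ∀ {m n} → 0 ℕ.< m → m ℕ.≤ n ∸ 1 → m ℕ.< n
  ≤∸1⇒< {n = zero}  0<m m≤0 = ⊥-elim (ℕ.<⇒≱ 0<m m≤0)
  ≤∸1⇒< {n = suc n} _   m≤n = s≤s m≤n

  to : 2 ℕ.≤ (F i ∸ 1) / F k → k ℕ.+ 2 ℕ.≤ i
  to 2≤r = ℕ.≮⇒≥ λ i<k+2 → ℕ.<⇒≱
    (begin-strict
      2 ℕ.* F k                <⟨ ≤∸1⇒< (ℕ.≤-trans 0<q (ℕ.m≤m+n (F k) (F k ℕ.+ 0)))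
                                   (ℕ.≤-trans (ℕ.*-monoˡ-≤ (F k) 2≤r) (m/n*n≤m (F i ∸ 1) (F k))) ⟩
      F i                      ≤⟨ F-mono (ℕ.s≤s⁻¹ (ℕ.≤-trans i<k+2 (ℕ.≤-reflexive (ℕ.+-comm k 2)))) ⟩
      F k ℕ.+ F (2 ℕ.+ j)      ∎)
    (ℕ.+-monoʳ-≤ (F k) (ℕ.≤-trans (F-step (2 ℕ.+ j)) (ℕ.m≤m+n (F k) 0)))

  from : k ℕ.+ 2 ℕ.≤ i → 2 ℕ.≤ (F i ∸ 1) / F k
  from k+2≤i = begin
    2                          ≡⟨ sym (m*n/n≡m 2 (F k)) ⟩
    (2 ℕ.* F k) / F k          ≤⟨ /-monoˡ-≤ (F k) (ℕ.∸-monoˡ-≤ 1 (begin-strict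
      2 ℕ.* F k                  ≡⟨ cong (λ t → F k ℕ.+ t) (ℕ.+-identityʳ (F k)) ⟩
      F k ℕ.+ F k                <⟨ ℕ.+-monoˡ-< (F k) (ℕ.m<m+n (F k) (F-positive (1 ℕ.+ j))) ⟩
      F (2 ℕ.+ k)                ≤⟨ F-mono (ℕ.≤-trans (ℕ.≤-reflexive (ℕ.+-comm 2 k)) k+2≤i) ⟩
      F i                        ∎)) ⟩
    (F i ∸ 1) / F k            ∎

-- The cases use indices such as `2 + i`, the statement `i + 2`; abstracting the value over both
-- indices moves it together with the generators.
transport : ∀ i {m m′ n n′} (g : ℕ → ℕ → ℤ) → m ≡ m′ → n ≡ n′ →
  IsFrobeniusNumber 2 (F i ∷ F m ∷ F n ∷ []) (g m n) →
  IsFrobeniusNumber 2 (F i ∷ F m′ ∷ F n′ ∷ []) (g m′ n′)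
transport i g refl refl isF = isF

theorem3 : (∀ i k → 3 ℕ.≤ i → 3 ℕ.≤ k → i ℕ.+ 3 ℕ.≤ k →
    IsFrobeniusNumber 2 (F i ∷ F (i ℕ.+ 2) ∷ F (i ℕ.+ k) ∷ [])
    ((+ 3 * + F i - + 1) * + F (i ℕ.+ 2) - + F i))
    × (∀ i → 3 ℕ.≤ i →
    (2 ∤ i →
    IsFrobeniusNumber 2 (F i ∷ F (i ℕ.+ 2) ∷ F (2 ℕ.* i ℕ.+ 2) ∷ [])
    ((+ F (i ∸ 2) - + 1) * + F (i ℕ.+ 2) + + F (2 ℕ.* i ℕ.+ 2) - + F i))
    × (2 ∣ i →
    IsFrobeniusNumber 2 (F i ∷ F (i ℕ.+ 2) ∷ F (2 ℕ.* i ℕ.+ 2) ∷ [])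
    ((+ F (i ℕ.+ 2) - + 1) * + F (i ℕ.+ 2) - + F i)))
    × (∀ i → 3 ℕ.≤ i →
    IsFrobeniusNumber 2 (F i ∷ F (i ℕ.+ 2) ∷ F (2 ℕ.* i ℕ.+ 1) ∷ [])
    ((+ F i - + 1) * + F (i ℕ.+ 2) + + F (2 ℕ.* i ℕ.+ 1) - + F i))
    × (∀ i → 3 ℕ.≤ i →
    IsFrobeniusNumber 2 (F i ∷ F (i ℕ.+ 2) ∷ F (2 ℕ.* i) ∷ [])
    ((+ 2 * + F i - + 1) * + F (i ℕ.+ 2) - + F i))
    × ((∀ i → 5 ℕ.≤ i →
    IsFrobeniusNumber 2 (F i ∷ F (i ℕ.+ 2) ∷ F (2 ℕ.* i ∸ 1) ∷ [])
    ((+ F (i ∸ 4) - + 1) * + F (i ℕ.+ 2) + + 3 * + F (2 ℕ.* i ∸ 1) - + F i))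
    × IsFrobeniusNumber 2 (F 4 ∷ F 6 ∷ F 7 ∷ []) (+ F 6 + + 2 * + F 7 - + F 4)
    × + F 6 + + 2 * + F 7 - + F 4 ≡ + 31)
    × (∀ i k → 3 ℕ.≤ i → (3≤k : 3 ℕ.≤ k) →
    let r = _/_ (F i ∸ 1) (F k) {{F-nonZero 3≤k}} in
    (2 ℕ.≤ r ⇔ k ℕ.+ 2 ℕ.≤ i)
    × (2 ℕ.≤ r →
    ((+ F i - + r * + F k) * + F (i ℕ.+ 2) ≥ + F (k ∸ 2) * + F i →
    IsFrobeniusNumber 2 (F i ∷ F (i ℕ.+ 2) ∷ F (i ℕ.+ k) ∷ [])
    ((+ F i - + r * + F k - + 1) * + F (i ℕ.+ 2)
    + (+ r + + 2) * + F (i ℕ.+ k) - + F i))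
    × ((+ F i - + r * + F k) * + F (i ℕ.+ 2) < + F (k ∸ 2) * + F i →
    IsFrobeniusNumber 2 (F i ∷ F (i ℕ.+ 2) ∷ F (i ℕ.+ k) ∷ [])
    ((+ F k - + 1) * + F (i ℕ.+ 2)
    + (+ r + + 1) * + F (i ℕ.+ k) - + F i))))
theorem3 =
    part-a
  , part-b
  , part-c
  , part-d
  , (part-e , frobenius-3-8-13 (F-coprime 4) , refl)
  , (λ i k 3≤i 3≤k → two≤ratio⇔ i k 3≤k , part-f i k 3≤i 3≤k)
  where
  part-a : ∀ i k → 3 ℕ.≤ i → 3 ℕ.≤ k → i ℕ.+ 3 ℕ.≤ k →
    IsFrobeniusNumber 2 (F i ∷ F (i ℕ.+ 2) ∷ F (i ℕ.+ k) ∷ [])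
      ((+ 3 * + F i - + 1) * + F (i ℕ.+ 2) - + F i)
  part-a i (suc (suc j)) 3≤i _ i+3≤k =
    transport i (λ m _ → (+ 3 * + F i - + 1) * + F m - + F i)
      (ℕ.+-comm 2 i) (ℕ.+-comm (2 ℕ.+ j) i) (case-a i j 3≤i i+3≤k)
  part-a _ 1 _ (s≤s ())

  part-b : ∀ i → 3 ℕ.≤ i →
    (2 ∤ i →
      IsFrobeniusNumber 2 (F i ∷ F (i ℕ.+ 2) ∷ F (2 ℕ.* i ℕ.+ 2) ∷ [])
        ((+ F (i ∸ 2) - + 1) * + F (i ℕ.+ 2) + + F (2 ℕ.* i ℕ.+ 2) - + F i))
    × (2 ∣ i →
      IsFrobeniusNumber 2 (F i ∷ F (i ℕ.+ 2) ∷ F (2 ℕ.* i ℕ.+ 2) ∷ [])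
        ((+ F (i ℕ.+ 2) - + 1) * + F (i ℕ.+ 2) - + F i))
  part-b i 3≤i with n , refl ← ℕ.m≤n⇒∃[o]m+o≡n 3≤i =
      (λ 2∤i → transport i (λ m m′ → (+ F (1 ℕ.+ n) - + 1) * + F m + + F m′ - + F i)
        (ℕ.+-comm 2 i) (refl {x = 2 ℕ.* i ℕ.+ 2}) (case-b-odd n (2 ℕ.* i ℕ.+ 2) (arrange i) 2∤i))
    , (λ 2∣i → transport i (λ m _ → (+ F m - + 1) * + F m - + F i)
        (ℕ.+-comm 2 i) (refl {x = 2 ℕ.* i ℕ.+ 2}) (case-b-even n (2 ℕ.* i ℕ.+ 2) (arrange i) 2∣i))
    where
    arrange : ∀ i → 2 ℕ.* i ℕ.+ 2 ≡ 2 ℕ.+ i ℕ.+ i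
    arrange = solve-∀

  part-c : ∀ i → 3 ℕ.≤ i →
    IsFrobeniusNumber 2 (F i ∷ F (i ℕ.+ 2) ∷ F (2 ℕ.* i ℕ.+ 1) ∷ [])
      ((+ F i - + 1) * + F (i ℕ.+ 2) + + F (2 ℕ.* i ℕ.+ 1) - + F i)
  part-c i 3≤i with n , refl ← ℕ.m≤n⇒∃[o]m+o≡n 3≤i =
    transport i (λ m m′ → (+ F i - + 1) * + F m + + F m′ - + F i)
      (ℕ.+-comm 2 i) (refl {x = 2 ℕ.* i ℕ.+ 1}) (case-c n (2 ℕ.* i ℕ.+ 1) (arrange i))
    where
    arrange : ∀ i → 2 ℕ.* i ℕ.+ 1 ≡ 1 ℕ.+ i ℕ.+ i
    arrange = solve-∀

  part-d : ∀ i → 3 ℕ.≤ i →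
    IsFrobeniusNumber 2 (F i ∷ F (i ℕ.+ 2) ∷ F (2 ℕ.* i) ∷ [])
      ((+ 2 * + F i - + 1) * + F (i ℕ.+ 2) - + F i)
  part-d i 3≤i with n , refl ← ℕ.m≤n⇒∃[o]m+o≡n 3≤i =
    transport i (λ m _ → (+ 2 * + F i - + 1) * + F m - + F i)
      (ℕ.+-comm 2 i) (refl {x = 2 ℕ.* i}) (case-d n (2 ℕ.* i) (cong (λ t → i ℕ.+ t) (ℕ.+-identityʳ i)))

  part-e : ∀ i → 5 ℕ.≤ i →
    IsFrobeniusNumber 2 (F i ∷ F (i ℕ.+ 2) ∷ F (2 ℕ.* i ∸ 1) ∷ [])
      ((+ F (i ∸ 4) - + 1) * + F (i ℕ.+ 2) + + 3 * + F (2 ℕ.* i ∸ 1) - + F i)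
  part-e i 5≤i with n , refl ← ℕ.m≤n⇒∃[o]m+o≡n 5≤i =
    -- For i = 5 + n the truncated `2 * i ∸ 1` computes to `4 + n + (i + 0)`.
    transport i (λ m m′ → (+ F (1 ℕ.+ n) - + 1) * + F m + + 3 * + F m′ - + F i)
      (ℕ.+-comm 2 i) (refl {x = 2 ℕ.* i ∸ 1}) (case-e n (2 ℕ.* i ∸ 1) (cong (λ t → 4 ℕ.+ n ℕ.+ t) (ℕ.+-identityʳ i)))

  part-f : ∀ i k → 3 ℕ.≤ i → (3≤k : 3 ℕ.≤ k) →
    let r = _/_ (F i ∸ 1) (F k) {{F-nonZero 3≤k}} in
    2 ℕ.≤ r →
      ((+ F i - + r * + F k) * + F (i ℕ.+ 2) ≥ + F (k ∸ 2) * + F i →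
        IsFrobeniusNumber 2 (F i ∷ F (i ℕ.+ 2) ∷ F (i ℕ.+ k) ∷ [])
          ((+ F i - + r * + F k - + 1) * + F (i ℕ.+ 2) + (+ r + + 2) * + F (i ℕ.+ k) - + F i))
      × ((+ F i - + r * + F k) * + F (i ℕ.+ 2) < + F (k ∸ 2) * + F i →
        IsFrobeniusNumber 2 (F i ∷ F (i ℕ.+ 2) ∷ F (i ℕ.+ k) ∷ [])
          ((+ F k - + 1) * + F (i ℕ.+ 2) + (+ r + + 1) * + F (i ℕ.+ k) - + F i))
  part-f _ 1 _ (s≤s ())
  part-f zero _ ()
  part-f i@(suc i′) (suc (suc j)) 3≤i 3≤k 2≤r =
      (λ ge → transport i (λ m m′ → (+ F i - + r * + F k - + 1) * + F m + (+ r + + 2) * + F m′ - + F i)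
        (ℕ.+-comm 2 i) (ℕ.+-comm k i)
        (C.case-f₁ (subst (λ m → (+ F i - + r * + F k) * + F m ≥ + F j * + F i) (ℕ.+-comm i 2) ge)))
    , (λ lt → transport i (λ m m′ → (+ F k - + 1) * + F m + (+ r + + 1) * + F m′ - + F i)
        (ℕ.+-comm 2 i) (ℕ.+-comm k i)
        (C.case-f₂ (subst (λ m → (+ F i - + r * + F k) * + F m < + F j * + F i) (ℕ.+-comm i 2) lt)))
    where
    k = 2 ℕ.+ j
    instance q≢0 = F-nonZero {k = k} 3≤k
    r = (F i ∸ 1) / F k
    -- Dividing F_i - 1 rather than F_i makes F_i - r F_k equal to H + 1, between 1 and F_k.
    H = (F i ∸ 1) % F k
    H≡ : suc H ℕ.+ r ℕ.* F k ≡ F i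
    H≡ = trans (cong suc (sym (m≡m%n+[m/n]*n (F i ∸ 1) (F k))))
      (ℕ.suc-pred (F i) {{ℕ.>-nonZero (F-positive i′)}})
    module C = CaseF i j r H H≡ (m%n<n (F i ∸ 1) (F k)) 2≤r
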